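{- Consider the following decision problem (Task 1): given a finite set of agents $\mathcal A$, a finite $\Sigma_o$-structure $I_o$ with domain $D\supseteq\mathcal A$, a finite distributed theory $\mathcal T$ and a sentence $\varphi$ of the form $K_t\psi$ with $t$ a $\Sigma_o$-term, decide whether $\varphi$ has value $\mathbf t$ in the well-founded model of $\mathcal T$ with respect to $I_o$. In terms of data complexity (with $\mathcal A$, the vocabulary, $\mathcal T$ and $\varphi$ fixed and the input being $I_o$), this problem is NP-hard and co-NP-hard: there exist a fixed finite set of agents, a fixed vocabulary $\Sigma=\Sigma_o\uplus\Sigma_s$, a fixed finite distributed theory $\mathcal T$ and fixed sentences $\varphi_1,\varphi_2$ of the form $K_t\psi$ ($t$ a $\Sigma_o$-term) such that deciding, given a finite $\Sigma_o$-structure $I_o$ (interpreting agent constants and $\mathrm{Apred}$ as required), whether $\varphi_1$ holds in the WF-model is NP-hard, and whether $\varphi_2$ holds in the WF-model is co-NP-hard.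
   Context: Standing setup (dAEL). $\Sigma=\Sigma_o\uplus\Sigma_s$ is a first-order vocabulary (objective and subjective symbols). A nonempty domain $D$ and a $\Sigma_o$-structure $I_o$ with domain $D$ are given, as is a set of agents $\mathcal{A}\subseteq D$. For each $A\in\mathcal{A}$ there is a constant $A\in\Sigma_o$ with $A^{I_o}=A$, and $\Sigma_o$ contains a unary predicate $\mathrm{Apred}$ with $\mathrm{Apred}^{I_o}=\mathcal{A}$. "Structure" means a $\Sigma$-structure with domain $D$ that agrees with $I_o$ on $\Sigma_o$. Formulas of dAEL are built from atoms $P(\bar t)$ ($P\in\Sigma$ or equality) using $\wedge,\neg,\forall x$, and the modal rule: if $\varphi$ is a formula and $t$ a term then $K_t\varphi$ is a formula ($\vee,\Rightarrow,\Leftrightarrow,\exists$ are the usual abbreviations). Truth values are $\mathbf t,\mathbf f,\mathbf u$ with truth order $\mathbf f<_t\mathbf u<_t\mathbf t$; $\mathbf t^{ -1}=\mathbf f$, $\mathbf f^{ -1}=\mathbf t$, $\mathbf u^{ -1}=\mathbf u$. A possible world structure (PWS) is a set of structures; $Q_1\le_K Q_2$ iff $Q_2\subseteq Q_1$. A distributed possible world structure (DPWS) is a family $\mathcal Q=(\mathcal Q_A)_{A\in\mathcal A}$ of PWSs, ordered pointwise by $\le_K$. A distributed belief pair (DBP) is a pair $\mathcal B=(\mathcal B^c,\mathcal B^l)$ of DPWSs; $(\mathcal P,\mathcal S)\le_p(\mathcal P',\mathcal S')$ iff $\mathcal P\le_K\mathcal P'$ and $\mathcal S'\le_K\mathcal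 S$; DBPs are assumed consistent ($\mathcal B^l_A\subseteq\mathcal B^c_A$ for all $A$). Three-valued value $\varphi^{\mathcal B,I,a}$ for any pair $\mathcal B$ of DPWSs, structure $I$, assignment $a$: atoms get their two-valued value in $I$; $\neg$ is interpreted by ${}^{ -1}$, and $\wedge$, $\forall$ by $\le_t$-greatest lower bound (Kleene); $(K_t\varphi)^{\mathcal B,I,a}$ is $\mathbf t$ if $t^{I,a}\in\mathcal A$ and $\varphi^{\mathcal B,J,a}=\mathbf t$ for all $J\in\mathcal B^c_{t^{I,a}}$; it is $\mathbf f$ if $t^{I,a}\notin\mathcal A$ or $\varphi^{\mathcal B,J,a}=\mathbf f$ for some $J\in\mathcal B^l_{t^{I,a}}$; and $\mathbf u$ otherwise. For sentences the assignment is omitted, and the value of a set of sentences is the $\le_t$-glb of the values of its members; for $\varphi=K_t\psi$ with $t$ a $\Sigma_o$-term the value does not depend on $I$. A distributed theory is a family $\mathcal T=(\mathcal T_A)_{A\in\mathcal A}$ of sets of dAEL sentences. $D^c_{\mathcal T}(\mathcal B)_A=\{I:\mathcal T_A^{\mathcal B,I}\ne\mathbf f\}$; the stable operator $S_{\mathcal T}(\mathcal Q)$ is the $\le_K$-least fixpoint of $\mathcal Q'\mapsto D^c_{\mathcal T}((\mathcal Q',\mathcal Q))$. A PSt-model is a DBP $\mathcal B$ with $\mathcal B^c=S_{\mathcal T}(\mathcal B^l)$ and $\mathcal B^l=S_{\mathcal T}(\mathcal B^c)$; the well-founded (WF) model is the $\le_p$-least PSt-model. -}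

module Defs where

open import Data.Bool.Base using (Bool; true; false)
open import Data.Fin.Base using (Fin; zero; suc)
open import Data.List.Base using (List; []; _∷_; _++_; length; replicate; map; concatMap; allFin)
open import Data.List.Membership.Propositional using (_∈_)
open import Data.List.Relation.Unary.All using (All)
open import Data.List.Relation.Unary.Any using (Any)
open import Data.Nat.Base using (ℕ; zero; suc; _+_; _*_; _≤_; NonZero)
open import Data.Product.Base using (Σ; Σ-syntax; ∃-syntax; _×_; _,_)
open import Data.Sum.Base using (_⊎_; inj₁; inj₂; [_,_]′)
open import Data.Vec.Base using (Vec; []; _∷_; lookup)
import Data.Vec.Base as Vec
open import Function.Base using (_∘_)
open import Function.Bundles using (_↔_; _⇔_; Inverse)
open import Function.Definitions using (Injective)
open import Level using (0ℓ)
open import Relation.Binary.PropositionalEquality using (_≡_; _≢_; sym; subst)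
open import Relation.Nullary.Negation using (¬_)
open import Relation.Unary using (Pred; _⊆_; _≐_)

Finite : Set → Set
Finite X = ∃[ n ] (X ↔ Fin n)

enumerate : ∀ {X} → Finite X → List X
enumerate (n , e) = map (Inverse.from e) (allFin n)

Word : Set
Word = List Bool

Language : Set₁
Language = Pred Word 0ℓ

data Symbol (Aux : Set) : Set where
  blank : Symbol Aux
  bit   : Bool → Symbol Aux
  aux   : Aux → Symbol Aux

data Move : Set where
  left stay right : Move

-- A two-way infinite tape: the cells to the left of the head (nearest first),
-- the scanned cell, and the cells to its right.  All cells beyond the two
-- lists are blank.
record Tape (Γ : Set) : Set where
  constructor tape
  field
    before  : List Γ
    scanned : Γ
    after   : List Γ

open Tape public

module _ {Aux : Set} where

  emptyTape : Tape (Symbol Aux)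
  emptyTape = tape [] blank []

  inputTape : Word → Tape (Symbol Aux)
  inputTape []       = emptyTape
  inputTape (b ∷ bs) = tape [] (bit b) (map bit bs)

  moveHead : Move → Tape (Symbol Aux) → Tape (Symbol Aux)
  moveHead left  (tape []       s rs)       = tape [] blank (s ∷ rs)
  moveHead left  (tape (l ∷ ls) s rs)       = tape ls l (s ∷ rs)
  moveHead stay  t                          = t
  moveHead right (tape ls       s [])       = tape (s ∷ ls) blank []
  moveHead right (tape ls       s (r ∷ rs)) = tape (s ∷ ls) r rs

  writeMove : Symbol Aux × Move → Tape (Symbol Aux) → Tape (Symbol Aux)
  writeMove (s , m) t = moveHead m (record t { scanned = s })

  leadingBits : List (Symbol Aux) → Word
  leadingBits (bit b ∷ ss) = b ∷ leadingBits ss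
  leadingBits _            = []

  -- The word that starts at the head and extends to the first non-bit cell.
  tapeWord : Tape (Symbol Aux) → Word
  tapeWord t = leadingBits (scanned t ∷ after t)

-- Nondeterministic multi-tape machines: tape 0 carries the input, tape 1 the
-- output, and the others are work tapes.  A machine halts when its (finite)
-- list of applicable actions is empty.
record TM : Set₁ where
  field
    workTapes    : ℕ
    State        : Set
    Aux          : Set
    finite-State : Finite State
    finite-Aux   : Finite Aux

  tapes : ℕ
  tapes = 2 + workTapes

  Action : Set
  Action = State × Vec (Symbol Aux × Move) tapes

  field
    start     : State
    accepting : State → Bool
    δ         : State → Vec (Symbol Aux) tapes → List Action

  record Config : Set where
    constructor config
    field
      state    : State
      contents : Vec (Tape (Symbol Aux)) tapes

  open Config public

  initial : Word → Config
  initial x = config start (inputTape x ∷ Vec.replicate _ emptyTape)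

  actions : Config → List Action
  actions c = δ (state c) (Vec.map scanned (contents c))

  perform : Action → Config → Config
  perform (q , ws) c = config q (Vec.zipWith writeMove ws (contents c))

  Step : Config → Config → Set
  Step c c′ = ∃[ a ] (a ∈ actions c × c′ ≡ perform a c)

  data Run : ℕ → Config → Config → Set where
    done : ∀ {c} → Run zero c c
    _▸_  : ∀ {n c c′ c″} → Step c c′ → Run n c′ c″ → Run (suc n) c c″

  Halted : Config → Set
  Halted c = actions c ≡ []

  Accepts : Word → Set
  Accepts x = ∃[ n ] ∃[ c ]
    (Run n (initial x) c × Halted c × accepting (state c) ≡ true)

  output : Config → Word
  output c = tapeWord (lookup (contents c) (suc zero))

  Deterministic : Set
  Deterministic = ∀ q ss → length (δ q ss) ≤ 1

  -- On an input x, every computation branch has at most t (length x) steps.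
  RunsInTime : (ℕ → ℕ) → Set
  RunsInTime t = ∀ x n c → Run n (initial x) c → n ≤ t (length x)

  Computes : (Word → Word) → Set
  Computes f = ∀ x → ∃[ n ] ∃[ c ]
    (Run n (initial x) c × Halted c × output c ≡ f x)

-- Coefficients, constant term first.
Polynomial : Set
Polynomial = List ℕ

evalPoly : Polynomial → ℕ → ℕ
evalPoly []       n = 0
evalPoly (c ∷ cs) n = c + n * evalPoly cs n

InNP : Language → Set₁
InNP L = Σ[ M ∈ TM ] Σ[ p ∈ Polynomial ]
  (TM.RunsInTime M (evalPoly p) × (∀ x → L x ⇔ TM.Accepts M x))

InCoNP : Language → Set₁
InCoNP L = Σ[ L′ ∈ Language ] (InNP L′ × (∀ x → L x ⇔ (¬ L′ x)))

PolyTime : (Word → Word) → Set₁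
PolyTime f = Σ[ M ∈ TM ] Σ[ p ∈ Polynomial ]
  (TM.Deterministic M × TM.RunsInTime M (evalPoly p) × TM.Computes M f)

record DecisionProblem : Set₂ where
  field
    Instance : Set
    encode   : Instance → Word
    Yes      : Instance → Set₁

_≤ₚ_ : Language → DecisionProblem → Set₁
L ≤ₚ P = Σ[ r ∈ (Word → Instance) ]
  (PolyTime (encode ∘ r) × (∀ x → L x ⇔ Yes (r x)))
  where open DecisionProblem P

NPHard : DecisionProblem → Set₁
NPHard P = ∀ L → InNP L → L ≤ₚ P

CoNPHard : DecisionProblem → Set₁
CoNPHard P = ∀ L → InCoNP L → L ≤ₚ P

record Vocabulary : Set₁ where
  field
    FunSym   : Set
    PredSym  : Set
    funArity  : FunSym → ℕ
    predArity : PredSym → ℕ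

open Vocabulary public

record FiniteVocabulary (V : Vocabulary) : Set where
  field
    finite-FunSym  : Finite (FunSym V)
    finite-PredSym : Finite (PredSym V)

_⊎ᵛ_ : Vocabulary → Vocabulary → Vocabulary
V ⊎ᵛ W = record
  { FunSym    = FunSym V ⊎ FunSym W
  ; PredSym   = PredSym V ⊎ PredSym W
  ; funArity  = [ funArity V , funArity W ]′
  ; predArity = [ predArity V , predArity W ]′
  }

-- Terms with n free variables (de Bruijn indices).
data Term (V : Vocabulary) (n : ℕ) : Set where
  var : Fin n → Term V n
  app : (f : FunSym V) → Vec (Term V n) (funArity V f) → Term V n

mutual
  weakenᵗ : ∀ {V W n} → Term V n → Term (V ⊎ᵛ W) n
  weakenᵗ (var x)    = var x
  weakenᵗ (app f ts) = app (inj₁ f) (weakenᵗˢ ts)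

  weakenᵗˢ : ∀ {V W n k} → Vec (Term V n) k → Vec (Term (V ⊎ᵛ W) n) k
  weakenᵗˢ []       = []
  weakenᵗˢ (t ∷ ts) = weakenᵗ t ∷ weakenᵗˢ ts

record Interpretation (V : Vocabulary) (D : Set) : Set where
  field
    ⟦_⟧ᶠ : (f : FunSym V) → Vec D (funArity V f) → D
    ⟦_⟧ᵖ : (P : PredSym V) → Vec D (predArity V P) → Bool

open Interpretation public

_⊎ⁱ_ : ∀ {V W D} → Interpretation V D → Interpretation W D → Interpretation (V ⊎ᵛ W) D
I ⊎ⁱ J = record
  { ⟦_⟧ᶠ = λ { (inj₁ f) → ⟦ I ⟧ᶠ f ; (inj₂ g) → ⟦ J ⟧ᶠ g }
  ; ⟦_⟧ᵖ = λ { (inj₁ P) → ⟦ I ⟧ᵖ P ; (inj₂ R) → ⟦ J ⟧ᵖ R }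
  }

mutual
  evalᵗ : ∀ {V D n} → Interpretation V D → Vec D n → Term V n → D
  evalᵗ I a (var x)    = lookup a x
  evalᵗ I a (app f ts) = ⟦ I ⟧ᶠ f (evalᵗˢ I a ts)

  evalᵗˢ : ∀ {V D n k} → Interpretation V D → Vec D n → Vec (Term V n) k → Vec D k
  evalᵗˢ I a []       = []
  evalᵗˢ I a (t ∷ ts) = evalᵗ I a t ∷ evalᵗˢ I a ts

-- The fixed set 𝒜 of m agents is Fin m.
record ObjectiveVocabulary (m : ℕ) : Set₁ where
  field
    voc              : Vocabulary
    agentConst       : Fin m → FunSym voc
    agentConst-arity : ∀ A → funArity voc (agentConst A) ≡ 0
    Apred            : PredSym voc
    Apred-arity      : predArity voc Apred ≡ 1

open ObjectiveVocabulary public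

-- The inclusion 𝒜 ⊆ D is the injection sending an agent to the value of its
-- constant, so that Aᴵᵒ = A holds under the identification of 𝒜 with its image.
record ObjectiveStructure {m : ℕ} (Σₒ : ObjectiveVocabulary m) (D : Set) : Set where
  field
    interp : Interpretation (voc Σₒ) D

  agent : Fin m → D
  agent A = ⟦ interp ⟧ᶠ (agentConst Σₒ A)
              (subst (Vec D) (sym (agentConst-arity Σₒ A)) [])

  isAgent : D → Bool
  isAgent d = ⟦ interp ⟧ᵖ (Apred Σₒ)
                (subst (Vec D) (sym (Apred-arity Σₒ)) (d ∷ []))

  field
    agent-injective : Injective _≡_ _≡_ agent
    Apred-correct   : ∀ d → isAgent d ≡ true ⇔ (∃[ A ] agent A ≡ d)

open ObjectiveStructure public

data Formula (V : Vocabulary) (n : ℕ) : Set where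
  pred : (P : PredSym V) → Vec (Term V n) (predArity V P) → Formula V n
  _≈_  : Term V n → Term V n → Formula V n
  _∧_  : Formula V n → Formula V n → Formula V n
  ∼_   : Formula V n → Formula V n
  all  : Formula V (suc n) → Formula V n
  K    : Term V n → Formula V n → Formula V n

Sentence : Vocabulary → Set
Sentence V = Formula V 0

FiniteTheory : ℕ → Vocabulary → Set
FiniteTheory m V = Fin m → List (Sentence V)

data TruthValue : Set where
  𝐭 𝐮 𝐟 : TruthValue

module Semantics {m : ℕ} (Σₒ : ObjectiveVocabulary m) (Σₛ : Vocabulary)
                 {D : Set} (Iₒ : ObjectiveStructure Σₒ D) where

  Voc : Vocabulary
  Voc = voc Σₒ ⊎ᵛ Σₛ

  -- A (Σₒ ⊎ Σₛ)-structure that agrees with Iₒ on Σₒ is given by its Σₛ-part.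
  Structure : Set
  Structure = Interpretation Σₛ D

  full : Structure → Interpretation Voc D
  full I = interp Iₒ ⊎ⁱ I

  PWS : Set₁
  PWS = Pred Structure 0ℓ

  DPWS : Set₁
  DPWS = Fin m → PWS

  _≤ᴷ_ : DPWS → DPWS → Set
  Q₁ ≤ᴷ Q₂ = ∀ A → Q₂ A ⊆ Q₁ A

  -- Equality of sets of structures is extensional.
  _≐ᴷ_ : DPWS → DPWS → Set
  Q₁ ≐ᴷ Q₂ = ∀ A → Q₁ A ≐ Q₂ A

  record BeliefPair : Set₁ where
    constructor ⟨_,_⟩
    field
      conservative : DPWS
      liberal      : DPWS

  open BeliefPair public

  Consistent : BeliefPair → Set
  Consistent B = ∀ A → liberal B A ⊆ conservative B A

  _≤ᵖ_ : BeliefPair → BeliefPair → Set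
  B ≤ᵖ B′ = (conservative B ≤ᴷ conservative B′) × (liberal B′ ≤ᴷ liberal B)

  -- The clauses for 𝐭 and 𝐟 of the three-valued valuation.  They are mutually
  -- exclusive for consistent pairs.  For an inconsistent pair the 𝐭-clause and
  -- the 𝐟-clause for K may both apply; keeping both makes 𝐭 and 𝐟 monotone in
  -- B for ≤ᵖ on all pairs, hence Q′ ↦ Dᶜ ⟨ Q′ , Q ⟩ monotone for ≤ᴷ.
  mutual
    IsTrue : ∀ {n} → BeliefPair → Structure → Vec D n → Formula Voc n → Set
    IsTrue B I a (pred P ts) = ⟦ full I ⟧ᵖ P (evalᵗˢ (full I) a ts) ≡ true
    IsTrue B I a (s ≈ t)     = evalᵗ (full I) a s ≡ evalᵗ (full I) a t
    IsTrue B I a (φ ∧ ψ)     = IsTrue B I a φ × IsTrue B I a ψ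
    IsTrue B I a (∼ φ)       = IsFalse B I a φ
    IsTrue B I a (all φ)     = ∀ d → IsTrue B I (d ∷ a) φ
    IsTrue B I a (K t φ)     = ∃[ A ] (agent Iₒ A ≡ evalᵗ (full I) a t
                                 × (∀ J → conservative B A J → IsTrue B J a φ))

    IsFalse : ∀ {n} → BeliefPair → Structure → Vec D n → Formula Voc n → Set
    IsFalse B I a (pred P ts) = ⟦ full I ⟧ᵖ P (evalᵗˢ (full I) a ts) ≡ false
    IsFalse B I a (s ≈ t)     = evalᵗ (full I) a s ≢ evalᵗ (full I) a t
    IsFalse B I a (φ ∧ ψ)     = IsFalse B I a φ ⊎ IsFalse B I a ψ
    IsFalse B I a (∼ φ)       = IsTrue B I a φ
    IsFalse B I a (all φ)     = ∃[ d ] IsFalse B I (d ∷ a) φ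
    IsFalse B I a (K t φ)     = (¬ (∃[ A ] agent Iₒ A ≡ evalᵗ (full I) a t))
                              ⊎ (∃[ A ] (agent Iₒ A ≡ evalᵗ (full I) a t
                                  × (∃[ J ] (liberal B A J × IsFalse B J a φ))))

  HasValue : ∀ {n} → BeliefPair → Structure → Vec D n → Formula Voc n → TruthValue → Set
  HasValue B I a φ 𝐭 = IsTrue B I a φ
  HasValue B I a φ 𝐟 = IsFalse B I a φ
  HasValue B I a φ 𝐮 = (¬ IsTrue B I a φ) × (¬ IsFalse B I a φ)

  SetHasValue : BeliefPair → Structure → List (Sentence Voc) → TruthValue → Set
  SetHasValue B I Φ 𝐭 = All (λ φ → HasValue B I [] φ 𝐭) Φ
  SetHasValue B I Φ 𝐟 = Any (λ φ → HasValue B I [] φ 𝐟) Φ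
  SetHasValue B I Φ 𝐮 = (¬ SetHasValue B I Φ 𝐭) × (¬ SetHasValue B I Φ 𝐟)

  module _ (T : FiniteTheory m Voc) where

    Dᶜ : BeliefPair → DPWS
    Dᶜ B A I = ¬ SetHasValue B I (T A) 𝐟

    IsFixpoint : DPWS → DPWS → Set
    IsFixpoint Q Q′ = Q′ ≐ᴷ Dᶜ ⟨ Q′ , Q ⟩

    -- The graph of the stable operator: Q′ = S_T(Q).
    IsStable : DPWS → DPWS → Set₁
    IsStable Q Q′ = IsFixpoint Q Q′ × (∀ Q″ → IsFixpoint Q Q″ → Q′ ≤ᴷ Q″)

    IsPStModel : BeliefPair → Set₁
    IsPStModel B = Consistent B
                 × IsStable (liberal B) (conservative B)
                 × IsStable (conservative B) (liberal B)

    IsWFModel : BeliefPair → Set₁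
    IsWFModel B = IsPStModel B × (∀ B′ → IsPStModel B′ → B ≤ᵖ B′)

module _ {m : ℕ} (Σₒ : ObjectiveVocabulary m) where

  record FiniteStructure : Set where
    field
      size      : ℕ
      nonEmpty  : NonZero size
      structure : ObjectiveStructure Σₒ (Fin size)

  open FiniteStructure public

tuples : ∀ n k → List (Vec (Fin n) k)
tuples n zero    = [] ∷ []
tuples n (suc k) = concatMap (λ d → map (d ∷_) (tuples n k)) (allFin n)

oneHot : ∀ {n} → Fin n → Word
oneHot {suc n} zero    = true ∷ replicate n false
oneHot {suc n} (suc i) = false ∷ oneHot i

-- The domain size in unary, then for each function symbol the concatenated
-- one-hot codes of its values, then for each predicate symbol its bit table.
encodeStructure : ∀ {m} {Σₒ : ObjectiveVocabulary m} →
                  FiniteVocabulary (voc Σₒ) → FiniteStructure Σₒ → Word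
encodeStructure {Σₒ = Σₒ} fin S =
  replicate (size S) true ++ false ∷
  (concatMap (λ f → concatMap (λ v → oneHot (⟦ I ⟧ᶠ f v)) (tuples (size S) (funArity V f)))
             (enumerate finite-FunSym)
   ++ concatMap (λ P → map (⟦ I ⟧ᵖ P) (tuples (size S) (predArity V P)))
                (enumerate finite-PredSym))
  where
  open FiniteVocabulary fin
  V = voc Σₒ
  I = interp (structure S)

-- As t is an objective term, the value of K t ψ does not depend on the
-- structure I over which Yes quantifies.
Task1 : ∀ {m} (Σₒ : ObjectiveVocabulary m) → FiniteVocabulary (voc Σₒ) →
        (Σₛ : Vocabulary) → FiniteTheory m (voc Σₒ ⊎ᵛ Σₛ) →
        Term (voc Σₒ) 0 → Sentence (voc Σₒ ⊎ᵛ Σₛ) → DecisionProblem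
Task1 Σₒ fin Σₛ T t ψ = record
  { Instance = FiniteStructure Σₒ
  ; encode   = encodeStructure fin
  ; Yes      = λ S → let open Semantics Σₒ Σₛ (structure S) in
                 Σ[ B ∈ BeliefPair ]
                   (IsWFModel T B × (∀ I → HasValue B I [] (K (weakenᵗ t) ψ) 𝐭))
  }

{-# OPTIONS --safe #-}

-- With the empty theory every structure is possible, so the well-founded model
-- is the pair of full possible world structures; there K_A ¬K_A ¬θ says that
-- the first-order sentence θ has a model expanding Iₒ, and K_A ¬θ that it has
-- none.  As in the theorems of Cook, Levin and Fagin, θ can be fixed so that
-- its models are the accepting computations of a machine.  Here θ speaks of a
-- tiling of the torus D × D (time × space) by elements of D that satisfies a
-- horizontal and a vertical matching relation, where Iₒ supplies the bottom row
-- and both relations; the machine thus enters only through Iₒ.  A tile holds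
-- one column of the tapes, aligned at their heads, together with a
-- nondeterministic choice that the horizontal relation forces to agree along a
-- row.  Every row of the tiling is then the next configuration, correct within
-- a distance from the heads that shrinks by one per step.  The bit tables of Iₒ
-- consist of constant words padded by zeros, repeated polynomially often, and a
-- deterministic machine prints them by nested loops over unary counters.
module Submission where

open import Data.Bool.Base using (Bool; false; if_then_else_; true)
import Data.Bool.Properties as Bool
open import Data.Empty using (⊥; ⊥-elim)
open import Data.Fin.Base using (Fin; _↑ʳ_; _↑ˡ_; combine; fromℕ; inject₁; join; remQuot; splitAt; suc; toℕ; zero)
open import Data.Fin.Patterns using (0F; 1F; 2F; 3F; 4F)
import Data.Fin.Properties as Fin
open import Data.Integer.Base using (+_; -[1+_]; ℤ; ∣_∣)
open import Data.List.Base using (List; []; _++_; _ʳ++_; _∷_; allFin; concat; concatMap; length; map; replicate; tabulate)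
open import Data.List.Membership.Propositional using (_∈_)
import Data.List.Properties as List
open import Data.List.Relation.Unary.Any using (here)
open import Data.Maybe.Base using (Maybe; just; nothing)
open import Data.Nat.Base using (_*_; _+_; _<_; _∸_; _≤_; suc; s≤s; zero; z≤n; ℕ)
import Data.Nat.Properties as ℕ
open import Data.Nat.Tactic.RingSolver using (solve-∀)
open import Data.Product.Base using (_,_; _×_; proj₁; proj₂; Σ-syntax; ∃-syntax)
open import Data.Sum.Base using ([_,_]′; _⊎_; inj₁; inj₂)
open import Data.Sum.Function.Propositional using (_⊎-↔_)
open import Data.Unit.Base using (tt; ⊤)
import Data.Vec.Base as Vec
open import Data.Vec.Base using (Vec; []; _[_]≔_; _∷_; lookup; zipWith)
import Data.Vec.Properties as Vecₚ
open import Function.Base using (_$_; _∘_; id)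
open import Function.Bundles using (Equivalence; Inverse; _⇔_; mk⇔)
open import Function.Construct.Composition using (_↔-∘_; _⇔-∘_)
open import Function.Construct.Identity using (↔-id)
open import Function.Construct.Symmetry using (↔-sym; ⇔-sym)
open import Relation.Binary.Definitions using (DecidableEquality; tri<; tri>; tri≈)
open import Relation.Binary.PropositionalEquality using (_≡_; _≢_; cong; cong₂; module ≡-Reasoning; refl; subst; subst₂; sym; trans)
open import Relation.Nullary.Decidable using (dec-true)
open import Relation.Nullary.Decidable.Core using (Dec; _×-dec_; does; map′; no; yes)
open import Relation.Nullary.Negation.Core using (¬_)
open import Defs

-- Structured programs for deterministic machines

-- The vocabulary, the theory and the sentences are fixed before the language is given, and every
-- language brings its own machine. The sentence can therefore name no state or symbol, and the
-- matching rules have to be data. A torus replaces a grid because function symbols are total: a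
-- cyclic predecessor has no border, so one rule holds at every cell. Both wrap-arounds then need an
-- argument. In time, `final` rows may precede the `init` row. In space, the two ends of the tapes
-- meet at a seam: an actual run is blank there, whereas an arbitrary tiling may show anything there
-- and is trusted only in a window around the heads. The time bound ends the run before that window
-- closes. Acceptance is no clause of the sentence: a tiling can stop the run only at an accepting
-- halt, and the time bound forbids it to go on forever. Domain elements that code no tile are read
-- as `final`, which lets the domain grow with the input while the tables stay almost constant.

Cell : Set
Cell = Symbol (Fin 0)

Tapes : ℕ → Set
Tapes k = Vec (Tape Cell) k

-- Each tape sees only its own cell. Different tapes influence each other only through the tests of
-- `while` and `ifOne`.
Edit : Set
Edit = Cell → Cell × Move

edit : Edit → Tape Cell → Tape Cell
edit f t = writeMove (f (scanned t)) t

isBit : Cell → Bool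
isBit (bit _) = true
isBit _       = false

isOne : Cell → Bool
isOne (bit b) = b
isOne _       = false

Finite-⊤ : Finite ⊤
Finite-⊤ = 1 , ↔-sym Fin.1↔⊤

Finite-⊎ : ∀ {X Y} → Finite X → Finite Y → Finite (X ⊎ Y)
Finite-⊎ (m , e) (n , f) = m + n , (↔-sym Fin.+↔⊎ ↔-∘ (e ⊎-↔ f))

data Program (k : ℕ) : Set where
  act   : Vec Edit k → Program k
  _▹_   : Program k → Program k → Program k
  while : Fin k → Program k → Program k
  ifOne : Fin k → Program k → Program k → Program k

infixr 4 _▹_

module _ {k : ℕ} where

  -- The control points, later the states of the machine: one for each `act` and one for each test
  -- of a loop or conditional.
  Position : Program k → Set
  Position (act _)       = ⊤
  Position (p ▹ q)       = Position p ⊎ Position q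
  Position (while _ p)   = ⊤ ⊎ Position p
  Position (ifOne _ p q) = ⊤ ⊎ (Position p ⊎ Position q)

  entry : ∀ p → Position p
  entry (act _)       = tt
  entry (p ▹ q)       = inj₁ (entry p)
  entry (while _ p)   = inj₁ tt
  entry (ifOne _ p q) = inj₁ tt

  idle : Vec Cell k → Vec (Cell × Move) k
  idle = Vec.map (_, stay)

  redirect : ∀ {X Y W : Set} → ⊤ ⊎ Y → (X → Y) → (⊤ ⊎ X) × W → (⊤ ⊎ Y) × W
  redirect e f (inj₁ _ , w) = e , w
  redirect e f (inj₂ a , w) = inj₂ (f a) , w

  -- The left summand of the successor is the exit of the program.
  move : ∀ p → Position p → Vec Cell k → (⊤ ⊎ Position p) × Vec (Cell × Move) k
  move (act fs) _ ss = inj₁ tt , zipWith _$_ fs ss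
  move (p ▹ q) (inj₁ a) ss = redirect (inj₂ (inj₂ (entry q))) inj₁ (move p a ss)
  move (p ▹ q) (inj₂ b) ss = redirect (inj₁ tt) inj₂ (move q b ss)
  move (while i p) (inj₁ _) ss =
    (if isBit (lookup ss i) then inj₂ (inj₂ (entry p)) else inj₁ tt) , idle ss
  move (while i p) (inj₂ a) ss = redirect (inj₂ (inj₁ tt)) inj₂ (move p a ss)
  move (ifOne i p q) (inj₁ _) ss =
    inj₂ (inj₂ (if isOne (lookup ss i) then inj₁ (entry p) else inj₂ (entry q))) , idle ss
  move (ifOne i p q) (inj₂ (inj₁ a)) ss = redirect (inj₁ tt) (inj₂ ∘ inj₁) (move p a ss)
  move (ifOne i p q) (inj₂ (inj₂ b)) ss = redirect (inj₁ tt) (inj₂ ∘ inj₂) (move q b ss)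

  scan : Tapes k → Vec Cell k
  scan = Vec.map scanned

  data Reach (p : Program k) : Position p → Tapes k → ℕ → Tapes k → Set where
    leave : ∀ {a ts ts′} w → move p a (scan ts) ≡ (inj₁ tt , w) →
           zipWith writeMove w ts ≡ ts′ → Reach p a ts 1 ts′
    advance : ∀ {a b ts n ts′} w → move p a (scan ts) ≡ (inj₂ b , w) →
           Reach p b (zipWith writeMove w ts) n ts′ → Reach p a ts (suc n) ts′

  -- An upper bound on the steps, instead of their number, lets both branches of a conditional and
  -- all rounds of a loop share one cost.
  Exec : Program k → Tapes k → Tapes k → ℕ → Set
  Exec p ts ts′ c = ∃[ n ] (n ≤ c × Reach p (entry p) ts n ts′)

  idle-writes : ∀ {j} (ts : Tapes j) →
                zipWith writeMove (Vec.map (_, stay) (Vec.map scanned ts)) ts ≡ ts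
  idle-writes []       = refl
  idle-writes (t ∷ ts) = cong (t ∷_) (idle-writes ts)

  edit-writes : ∀ {j} (fs : Vec Edit j) (ts : Tapes j) →
                zipWith writeMove (zipWith _$_ fs (Vec.map scanned ts)) ts ≡ zipWith edit fs ts
  edit-writes []       []       = refl
  edit-writes (f ∷ fs) (t ∷ ts) = cong (edit f t ∷_) (edit-writes fs ts)

  act-exec : ∀ fs ts → Exec (act fs) ts (zipWith edit fs ts) 1
  act-exec fs ts = 1 , ℕ.≤-refl , leave _ refl (edit-writes fs ts)

  Exec-≤ : ∀ {p ts ts′ c d} → c ≤ d → Exec p ts ts′ c → Exec p ts ts′ d
  Exec-≤ c≤d (n , n≤c , r) = n , ℕ.≤-trans n≤c c≤d , r

  module _ {p q : Program k} where

    ▹-reachʳ : ∀ {b ts n ts′} → Reach q b ts n ts′ → Reach (p ▹ q) (inj₂ b) ts n ts′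
    ▹-reachʳ (leave w e f) = leave w (cong (redirect _ _) e) f
    ▹-reachʳ (advance w e r) = advance w (cong (redirect _ _) e) (▹-reachʳ r)

    ▹-reach : ∀ {a ts n ts′ m ts″} → Reach p a ts n ts′ → Reach q (entry q) ts′ m ts″ →
              Reach (p ▹ q) (inj₁ a) ts (n + m) ts″
    ▹-reach (leave w e refl) s = advance w (cong (redirect _ _) e) (▹-reachʳ s)
    ▹-reach (advance w e r)    s = advance w (cong (redirect _ _) e) (▹-reach r s)

    ▹-exec : ∀ {ts ts′ ts″ c d} → Exec p ts ts′ c → Exec q ts′ ts″ d →
             Exec (p ▹ q) ts ts″ (c + d)
    ▹-exec (n , n≤c , r) (m , m≤d , s) = n + m , ℕ.+-mono-≤ n≤c m≤d , ▹-reach r s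

  module _ {i : Fin k} {p : Program k} where

    while-reach : ∀ {a ts n ts′ m ts″} → Reach p a ts n ts′ →
                  Reach (while i p) (inj₁ tt) ts′ m ts″ →
                  Reach (while i p) (inj₂ a) ts (n + m) ts″
    while-reach (leave w e refl) s = advance w (cong (redirect _ _) e) s
    while-reach (advance w e r)    s = advance w (cong (redirect _ _) e) (while-reach r s)

    while-stop : ∀ {ts} → isBit (scanned (lookup ts i)) ≡ false → Exec (while i p) ts ts 1
    while-stop {ts} e = 1 , ℕ.≤-refl ,
      leave _ (cong (λ b → (if b then inj₂ (inj₂ (entry p)) else inj₁ tt) , idle (scan ts))
                   (trans (cong isBit (Vecₚ.lookup-map i scanned ts)) e))
             (idle-writes ts)

    while-step : ∀ {ts ts′ ts″ c d} → isBit (scanned (lookup ts i)) ≡ true →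
                 Exec p ts ts′ c → Exec (while i p) ts′ ts″ d →
                 Exec (while i p) ts ts″ (suc (c + d))
    while-step {ts} e (n , n≤c , r) (m , m≤d , s) =
      suc (n + m) , s≤s (ℕ.+-mono-≤ n≤c m≤d) ,
      advance _ (cong (λ b → (if b then inj₂ (inj₂ (entry p)) else inj₁ tt) , idle (scan ts))
                   (trans (cong isBit (Vecₚ.lookup-map i scanned ts)) e))
             (subst (λ us → Reach (while i p) (inj₂ (entry p)) us (n + m) _)
                    (sym (idle-writes ts)) (while-reach r s))

  module _ {i : Fin k} {p q : Program k} where

    ifOne-reachˡ : ∀ {a ts n ts′} → Reach p a ts n ts′ →
                   Reach (ifOne i p q) (inj₂ (inj₁ a)) ts n ts′
    ifOne-reachˡ (leave w e f) = leave w (cong (redirect _ _) e) f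
    ifOne-reachˡ (advance w e r) = advance w (cong (redirect _ _) e) (ifOne-reachˡ r)

    ifOne-reachʳ : ∀ {b ts n ts′} → Reach q b ts n ts′ →
                   Reach (ifOne i p q) (inj₂ (inj₂ b)) ts n ts′
    ifOne-reachʳ (leave w e f) = leave w (cong (redirect _ _) e) f
    ifOne-reachʳ (advance w e r) = advance w (cong (redirect _ _) e) (ifOne-reachʳ r)

    ifOne-exec : ∀ {ts ts′ c} b → isOne (scanned (lookup ts i)) ≡ b →
                 Exec (if b then p else q) ts ts′ c → Exec (ifOne i p q) ts ts′ (suc c)
    ifOne-exec {ts} b e (n , n≤c , r) = suc n , s≤s n≤c ,
      advance _ (cong (λ b → inj₂ (inj₂ (if b then inj₁ (entry p) else inj₂ (entry q))) , idle (scan ts))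
                   (trans (cong isOne (Vecₚ.lookup-map i scanned ts)) e))
             (subst (λ us → Reach (ifOne i p q) _ us n _) (sym (idle-writes ts)) (branch b r))
      where
      branch : ∀ b {us us′} → Reach (if b then p else q) (entry (if b then p else q)) us n us′ →
               Reach (ifOne i p q) (inj₂ (if b then inj₁ (entry p) else inj₂ (entry q))) us n us′
      branch true  = ifOne-reachˡ
      branch false = ifOne-reachʳ

  finite-Position : ∀ p → Finite (Position p)
  finite-Position (act _)       = Finite-⊤
  finite-Position (p ▹ q)       = Finite-⊎ (finite-Position p) (finite-Position q)
  finite-Position (while _ p)   = Finite-⊎ Finite-⊤ (finite-Position p)
  finite-Position (ifOne _ p q) =
    Finite-⊎ Finite-⊤ (Finite-⊎ (finite-Position p) (finite-Position q))

module _ {w : ℕ} (p : Program (2 + w)) where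

  compile : TM
  compile = record
    { workTapes    = w
    ; State        = ⊤ ⊎ Position p
    ; Aux          = Fin 0
    ; finite-State = Finite-⊎ Finite-⊤ (finite-Position p)
    ; finite-Aux   = 0 , ↔-id _
    ; start        = inj₂ (entry p)
    ; accepting    = λ _ → false
    ; δ            = λ { (inj₁ _) ss → [] ; (inj₂ a) ss → move p a ss ∷ [] }
    }

  open TM compile using (Step; Run; done; _▸_; Deterministic; config)

  compile-deterministic : Deterministic
  compile-deterministic (inj₁ _) ss = z≤n
  compile-deterministic (inj₂ _) ss = s≤s z≤n

  step-by : ∀ {a ts b w} → move p a (scan ts) ≡ (b , w) →
            Step (config (inj₂ a) ts) (config b (zipWith writeMove w ts))
  step-by {ts = ts} e =
    _ , here refl , cong (λ (b , w) → config b (zipWith writeMove w ts)) (sym e)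

  compile-run : ∀ {a ts n ts′} → Reach p a ts n ts′ →
                Run n (config (inj₂ a) ts) (config (inj₁ tt) ts′)
  compile-run (leave w e refl) = step-by e ▸ done
  compile-run (advance w e r) = step-by e ▸ compile-run r

module _ (M : TM) where
  open TM M

  -- Every run from `c` is a prefix of the halting one. `RunsInTime` speaks of all runs, and this
  -- reduces it to the single run that `Exec` provides.
  run-≤-halting : Deterministic → ∀ {c d e n k} → Run n c d → Halted d → Run k c e → k ≤ n
  run-≤-halting det _ _ done = z≤n
  run-≤-halting det done h ((a , a∈ , _) ▸ _) with () ← subst (a ∈_) h a∈
  run-≤-halting det {c} ((a , a∈ , refl) ▸ r) h ((b , b∈ , refl) ▸ s) =
    s≤s (run-≤-halting det r h (subst (λ a → Run _ (perform a c) _)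
      (unique (det (state c) (Vec.map scanned (contents c))) b∈ a∈) s))
    where
    unique : ∀ {as : List Action} {a b} → length as ≤ 1 → a ∈ as → b ∈ as → a ≡ b
    unique {_ ∷ []} _ (here p) (here q) = trans p (sym q)
    unique {_ ∷ _ ∷ _} (s≤s ()) _ _

-- Unary arithmetic on tapes

Exec-≡ : ∀ {k} {p : Program k} {ts ts′ us us′ c} → ts ≡ us → ts′ ≡ us′ →
         Exec p ts ts′ c → Exec p us us′ c
Exec-≡ refl refl e = e

load : List Cell → List Cell → Tape Cell
load ls []       = tape ls blank []
load ls (r ∷ rs) = tape ls r rs

-- The head scans the first bit of rs (or the blank that ends it), the bits ls
-- lie to its left, nearest first, and a blank separates them from the cells
-- junk, which are never visited again.
word : List Cell → List Bool → List Bool → Tape Cell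
word junk ls rs = load (map bit ls ++ blank ∷ junk) (map bit rs ++ blank ∷ [])

go : Move → Edit
go d s = s , d

keep : Edit
keep = go stay

put : Bool → Edit
put b _ = bit b , right

right-load : ∀ (ls : List Cell) s rs → moveHead right (tape ls s rs) ≡ load (s ∷ ls) rs
right-load ls s []       = refl
right-load ls s (r ∷ rs) = refl

right-word : ∀ junk ls b rs → edit (go right) (word junk ls (b ∷ rs)) ≡ word junk (b ∷ ls) rs
right-word junk ls b rs = right-load (map bit ls ++ blank ∷ junk) (bit b) _

-- The head stands one cell further left than in `word junk ls rs`; when `ls` is used up it is on
-- the separating blank, which stops the loop of `rewind`.
leftOf : List Cell → List Bool → List Bool → Tape Cell
leftOf junk []       rs = tape junk blank (map bit rs ++ blank ∷ [])
leftOf junk (b ∷ ls) rs = tape (map bit ls ++ blank ∷ junk) (bit b) (map bit rs ++ blank ∷ [])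

left-word : ∀ junk ls rs → edit (go left) (word junk ls rs) ≡ leftOf junk ls rs
left-word junk []       []       = refl
left-word junk []       (r ∷ rs) = refl
left-word junk (b ∷ ls) []       = refl
left-word junk (b ∷ ls) (r ∷ rs) = refl

left-leftOf : ∀ junk b ls rs → edit (go left) (leftOf junk (b ∷ ls) rs) ≡ leftOf junk ls (b ∷ rs)
left-leftOf junk b []       rs = refl
left-leftOf junk b (_ ∷ ls) rs = refl

right-leftOf : ∀ junk rs → edit (go right) (leftOf junk [] rs) ≡ word junk [] rs
right-leftOf junk rs = right-load junk blank _

-- One step left, a test and a step for each of the n bits, a failing test, and one step right.
rewindCost : ℕ → ℕ
rewindCost n = suc (suc (n * 2) + 1)

module _ {k : ℕ} where

  only : Fin k → Edit → Vec Edit k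
  only i f = Vec.replicate k keep [ i ]≔ f

  shift : Fin k → Move → Program k
  shift i d = act (only i (go d))

  rewind : Fin k → Program k
  rewind i = shift i left ▹ while i (shift i left) ▹ shift i right

  emit : Fin k → Word → Program k
  emit i []       = act (Vec.replicate k keep)
  emit i (b ∷ bs) = act (only i (put b)) ▹ emit i bs

  keep-edits : ∀ {j} (ts : Tapes j) → zipWith edit (Vec.replicate j keep) ts ≡ ts
  keep-edits []       = refl
  keep-edits (t ∷ ts) = cong (t ∷_) (keep-edits ts)

  only-edits : ∀ {j} (i : Fin j) f (ts : Tapes j) →
               zipWith edit (Vec.replicate j keep [ i ]≔ f) ts ≡ ts [ i ]≔ edit f (lookup ts i)
  only-edits zero    f (t ∷ ts) = cong (edit f t ∷_) (keep-edits ts)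
  only-edits (suc i) f (t ∷ ts) = cong (t ∷_) (only-edits i f ts)

  only-exec : ∀ i f {t u} ts → lookup ts i ≡ t → edit f t ≡ u →
              Exec (act (only i f)) ts (ts [ i ]≔ u) 1
  only-exec i f ts refl refl = Exec-≡ refl (only-edits i f ts) (act-exec (only i f) ts)

  -- The loop rule from which all traversals are derived. In the invariant `S`, `ls` are the bits
  -- already passed, `rs` those still ahead, and `acc` is the output so far in reverse; the round
  -- for bit `b` appends `w b`.
  while-word : ∀ {i p} (S : (ls rs acc : List Bool) → Tapes k) (w : Bool → List Bool) {c} →
               (∀ ls b rs acc → isBit (scanned (lookup (S ls (b ∷ rs) acc) i)) ≡ true) →
               (∀ ls acc → isBit (scanned (lookup (S ls [] acc) i)) ≡ false) →
               (∀ ls b rs acc → Exec p (S ls (b ∷ rs) acc) (S (b ∷ ls) rs (w b ʳ++ acc)) c) →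
               ∀ ls rs acc → Exec (while i p) (S ls rs acc)
                                  (S (rs ʳ++ ls) [] (concatMap w rs ʳ++ acc))
                                  (suc (length rs * suc c))
  while-word S w go-on stop body ls [] acc = while-stop (stop ls acc)
  while-word S w {c} go-on stop body ls (b ∷ rs) acc =
    Exec-≡ refl (cong (S _ []) (sym (List.++-ʳ++ (w b))))
      (Exec-≤ (ℕ.≤-reflexive (cong suc (ℕ.+-suc c _)))
        (while-step (go-on ls b rs acc) (body ls b rs acc)
          (while-word S w go-on stop body (b ∷ ls) rs (w b ʳ++ acc))))

  emit-exec : ∀ i w ts junk acc → lookup ts i ≡ word junk acc [] →
              Exec (emit i w) ts (ts [ i ]≔ word junk (w ʳ++ acc) []) (suc (length w))
  emit-exec i [] ts junk acc e =
    Exec-≡ refl (trans (keep-edits ts) (trans (sym (Vecₚ.[]≔-lookup ts i)) (cong (ts [ i ]≔_) e)))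
      (act-exec _ ts)
  emit-exec i (b ∷ w) ts junk acc e =
    Exec-≡ refl (Vecₚ.[]≔-idempotent ts i)
      (▹-exec (only-exec i (put b) ts e refl)
        (emit-exec i w _ junk (b ∷ acc) (Vecₚ.lookup∘update i ts _)))

  rewind-exec : ∀ {i} ts junk ws → lookup ts i ≡ word junk (ws ʳ++ []) [] →
                Exec (rewind i) ts (ts [ i ]≔ word junk [] ws) (rewindCost (length ws))
  rewind-exec {i} ts junk ws e =
    Exec-≤ (ℕ.≤-reflexive (cong rewindCost (trans (List.length-ʳ++ ws) (ℕ.+-identityʳ _))))
      (Exec-≡ refl
        (trans (Vecₚ.[]≔-idempotent ts i)
               (cong (λ v → ts [ i ]≔ word junk [] v)
                     (trans (List.ʳ++-ʳ++ ws) (List.++-identityʳ ws))))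
        (▹-exec (only-exec i (go left) ts e (left-word junk (ws ʳ++ []) []))
          (▹-exec
            (while-word S (λ _ → [])
              (λ ls b rs _ → cong (isBit ∘ scanned) (Vecₚ.lookup∘update i ts _))
              (λ ls _ → cong (isBit ∘ scanned) (Vecₚ.lookup∘update i ts _))
              (λ ls b rs _ → Exec-≡ refl (Vecₚ.[]≔-idempotent ts i)
                (only-exec i (go left) (ts [ i ]≔ _) (Vecₚ.lookup∘update i ts _) (left-leftOf junk b rs ls)))
              [] (ws ʳ++ []) [])
            (only-exec i (go right) _ (Vecₚ.lookup∘update i ts _) (right-leftOf junk _)))))
    where
    -- This loop runs leftwards, so the bits to the left of the head are the ones still ahead.
    S : (rs ls acc : List Bool) → Tapes k
    S rs ls _ = ts [ i ]≔ leftOf junk ls rs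

ones : ℕ → Word
ones n = replicate n true

replicate-+ : ∀ {A : Set} m n (a : A) → replicate (m + n) a ≡ replicate m a ++ replicate n a
replicate-+ zero    n a = refl
replicate-+ (suc m) n a = cong (a ∷_) (replicate-+ m n a)

ones-+ : ∀ m n → ones m ++ ones n ≡ ones (m + n)
ones-+ m n = sym (replicate-+ m n true)

concatMap-ones : ∀ n v → concatMap (λ _ → ones v) (ones n) ≡ ones (n * v)
concatMap-ones zero    v = refl
concatMap-ones (suc n) v = trans (cong (ones v ++_) (concatMap-ones n v)) (ones-+ v (n * v))

ones-length : ∀ (x : Word) → concatMap (λ _ → true ∷ []) x ≡ ones (length x)
ones-length []       = refl
ones-length (_ ∷ x) = cong (true ∷_) (ones-length x)

-- The five tapes are, in order, the input X, the output O, the counter C and the work tapes A and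
-- B.
A⇒B B⇒A : Vec Edit 5
A⇒B = keep ∷ keep ∷ keep ∷ go right ∷ put true ∷ []
B⇒A = keep ∷ keep ∷ keep ∷ put true ∷ go right ∷ []

addA : Program 5
addA = while 3F (act A⇒B) ▹ rewind 3F

-- A `word` needs a blank at its left end, which the first moves create on every tape. The loop
-- leaves one mark per input bit on C and also reaches the blank behind the input, so that the input
-- tape becomes a `word` as well.
prepare : Program 5
prepare = act (go left ∷ go right ∷ go right ∷ go right ∷ go right ∷ [])
        ▹ shift 0F right
        ▹ while 0F (act (go right ∷ keep ∷ put true ∷ keep ∷ keep ∷ []))
        ▹ rewind 0F
        ▹ rewind 2F

prepareCost : ℕ → ℕ
prepareCost n = 1 + (1 + (suc (n * 2) + (rewindCost n + rewindCost n)))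

prepare-exec : ∀ x → Exec prepare (inputTape x ∷ Vec.replicate 4 emptyTape)
                 (word [] [] x ∷ word [] [] [] ∷ word [] [] (ones (length x))
                   ∷ word [] [] [] ∷ word [] [] [] ∷ [])
                 (prepareCost (length x))
prepare-exec x =
  ▹-exec (act-exec _ _)
    (▹-exec (Exec-≡ refl (cong (_∷ _) (enter x)) (act-exec _ _))
      (▹-exec
        (while-word S (λ _ → true ∷ []) (λ _ _ _ _ → refl) (λ _ _ → refl)
          (λ ls b rs acc → Exec-≡ refl (cong (_∷ _) (right-load (map bit ls ++ blank ∷ []) (bit b) (map bit rs)))
            (act-exec _ _))
          [] x [])
        (▹-exec (rewind-exec _ [] x refl)
          (Exec-≤ (ℕ.≤-reflexive (cong rewindCost (List.length-replicate (length x))))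
            (rewind-exec _ [] (ones (length x))
              (cong (λ w → word [] (w ʳ++ []) []) (ones-length x)))))))
  where
  S : (ls rs acc : List Bool) → Tapes 5
  S ls rs acc = load (map bit ls ++ blank ∷ []) (map bit rs) ∷ word [] [] [] ∷ word [] acc []
              ∷ word [] [] [] ∷ word [] [] [] ∷ []
  enter : ∀ x → edit (go right) (edit (go left) (inputTape x)) ≡ load (blank ∷ []) (map bit x)
  enter []           = refl
  enter (b ∷ [])     = refl
  enter (b ∷ _ ∷ bs) = refl

-- With n bits on tape C, tape A goes from v to n * v + c bits.  A tape is
-- emptied by stepping past the blank at its end, which turns its former
-- contents into junk.
hornerStep : ℕ → Program 5
hornerStep c = while 2F (addA ▹ shift 2F right)
             ▹ rewind 2F
             ▹ emit 4F (ones c)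
             ▹ while 3F (shift 3F right)
             ▹ shift 3F right
             ▹ rewind 4F
             ▹ while 4F (act B⇒A)
             ▹ shift 4F right
             ▹ rewind 3F

addCost : ℕ → ℕ
addCost v = suc (v * 2) + rewindCost v

transfer-length : ∀ v → concatMap (λ _ → true ∷ []) (ones v) ≡ ones v
transfer-length v = trans (ones-length (ones v)) (cong ones (List.length-replicate v))

rewind-ones : ∀ {i : Fin 5} ts junk v → lookup ts i ≡ word junk (ones v ʳ++ []) [] →
              Exec (rewind i) ts (ts [ i ]≔ word junk [] (ones v)) (rewindCost v)
rewind-ones ts junk v e =
  Exec-≤ (ℕ.≤-reflexive (cong rewindCost (List.length-replicate v))) (rewind-exec ts junk (ones v) e)

hornerStepCost : ℕ → ℕ → ℕ → ℕ
hornerStepCost n c v =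
  let v′ = n * v + c in
  suc (n * suc (addCost v + 1)) + (rewindCost n + (suc c + (suc (v * 2) + (1 +
  (rewindCost v′ + (suc (v′ * 2) + (1 + rewindCost v′)))))))

module _ (X O : Tape Cell) (n : ℕ) where

  counted : Tape Cell
  counted = word [] [] (ones n)

  A⇒B-exec : ∀ C v JA JB acc →
    Exec (while 3F (act A⇒B)) (X ∷ O ∷ C ∷ word JA [] (ones v) ∷ word JB acc [] ∷ [])
                  (X ∷ O ∷ C ∷ word JA (ones v ʳ++ []) [] ∷ word JB (ones v ʳ++ acc) [] ∷ [])
                  (suc (v * 2))
  A⇒B-exec C v JA JB acc =
    Exec-≤ (ℕ.≤-reflexive (cong (λ l → suc (l * 2)) (List.length-replicate v)))
      (Exec-≡ refl (cong (λ w → S (ones v ʳ++ []) [] (w ʳ++ acc)) (transfer-length v))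
        (while-word S (λ _ → true ∷ []) (λ _ _ _ _ → refl) (λ _ _ → refl)
          (λ ls b rs acc → Exec-≡ refl (cong (λ t → _ ∷ _ ∷ _ ∷ t ∷ _ ∷ []) (right-word JA ls b rs))
            (act-exec A⇒B _))
          [] (ones v) acc))
    where
    S : (ls rs acc : List Bool) → Tapes 5
    S ls rs acc = X ∷ O ∷ C ∷ word JA ls rs ∷ word JB acc [] ∷ []

  B⇒A-exec : ∀ C v JA JB acc →
    Exec (while 4F (act B⇒A)) (X ∷ O ∷ C ∷ word JA acc [] ∷ word JB [] (ones v) ∷ [])
                  (X ∷ O ∷ C ∷ word JA (ones v ʳ++ acc) [] ∷ word JB (ones v ʳ++ []) [] ∷ [])
                  (suc (v * 2))
  B⇒A-exec C v JA JB acc =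
    Exec-≤ (ℕ.≤-reflexive (cong (λ l → suc (l * 2)) (List.length-replicate v)))
      (Exec-≡ refl (cong (λ w → S (ones v ʳ++ []) [] (w ʳ++ acc)) (transfer-length v))
        (while-word S (λ _ → true ∷ []) (λ _ _ _ _ → refl) (λ _ _ → refl)
          (λ ls b rs acc → Exec-≡ refl (cong (λ t → _ ∷ _ ∷ _ ∷ _ ∷ t ∷ []) (right-word JB ls b rs))
            (act-exec B⇒A _))
          [] (ones v) acc))
    where
    S : (ls rs acc : List Bool) → Tapes 5
    S ls rs acc = X ∷ O ∷ C ∷ word JA acc [] ∷ word JB ls rs ∷ []

  addA-exec : ∀ C v JA JB acc →
    Exec addA (X ∷ O ∷ C ∷ word JA [] (ones v) ∷ word JB acc [] ∷ [])
              (X ∷ O ∷ C ∷ word JA [] (ones v) ∷ word JB (ones v ʳ++ acc) [] ∷ [])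
              (addCost v)
  addA-exec C v JA JB acc = ▹-exec (A⇒B-exec C v JA JB acc) (rewind-ones _ JA v refl)

  skipA-exec : ∀ C B v JA →
    Exec (while 3F (shift 3F right)) (X ∷ O ∷ C ∷ word JA [] (ones v) ∷ B ∷ [])
         (X ∷ O ∷ C ∷ word JA (ones v ʳ++ []) [] ∷ B ∷ []) (suc (v * 2))
  skipA-exec C B v JA =
    Exec-≤ (ℕ.≤-reflexive (cong (λ l → suc (l * 2)) (List.length-replicate v)))
      (while-word S (λ _ → []) (λ _ _ _ _ → refl) (λ _ _ → refl)
        (λ ls b rs acc → only-exec 3F (go right) (S ls (b ∷ rs) acc) refl (right-word JA ls b rs))
        [] (ones v) [])
    where
    S : (ls rs acc : List Bool) → Tapes 5
    S ls rs _ = X ∷ O ∷ C ∷ word JA ls rs ∷ B ∷ []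

  hornerState : (v : ℕ) (JA JB : List Cell) → Tapes 5
  hornerState v JA JB = X ∷ O ∷ counted ∷ word JA [] (ones v) ∷ word JB [] [] ∷ []

  hornerStep-exec : ∀ c v JA JB → ∃[ JA′ ] ∃[ JB′ ]
    Exec (hornerStep c) (hornerState v JA JB) (hornerState (n * v + c) JA′ JB′) (hornerStepCost n c v)
  hornerStep-exec c v JA JB = _ , _ ,
    ▹-exec {ts = hornerState v JA JB}
      (Exec-≤ (ℕ.≤-reflexive (cong (λ l → suc (l * suc (addCost v + 1))) (List.length-replicate n)))
        (Exec-≡ refl (cong (λ w → S (ones n ʳ++ []) [] (w ʳ++ [])) (concatMap-ones n v))
          (while-word S (λ _ → ones v) (λ _ _ _ _ → refl) (λ _ _ → refl)
            (λ ls b rs acc → ▹-exec (addA-exec (word [] ls (b ∷ rs)) v JA JB acc)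
              (only-exec 2F (go right) (X ∷ O ∷ word [] ls (b ∷ rs) ∷ _ ∷ _ ∷ []) refl (right-word [] ls b rs)))
            [] (ones n) [])))
    (▹-exec (rewind-ones _ [] n refl)
    (▹-exec (Exec-≤ (ℕ.≤-reflexive (cong suc (List.length-replicate c)))
              (Exec-≡ refl
                (cong (λ w → X ∷ O ∷ counted ∷ word JA [] (ones v) ∷ word JB w [] ∷ [])
                      (trans (sym (List.++-ʳ++ (ones (n * v)))) (cong (_ʳ++ []) (ones-+ (n * v) c))))
                (emit-exec 4F (ones c) _ JB (ones (n * v) ʳ++ []) refl)))
    (▹-exec (skipA-exec counted _ v JA)
    (▹-exec (only-exec 3F (go right) _ refl refl)
    (▹-exec (rewind-ones _ JB v′ refl)
    (▹-exec (B⇒A-exec counted v′ JA′ JB [])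
    (▹-exec (only-exec 4F (go right) _ refl refl)
            (rewind-ones _ JA′ v′ refl))))))))
    where
    v′ = n * v + c
    JA′ = map bit (ones v ʳ++ []) ++ blank ∷ JA
    S : (ls rs acc : List Bool) → Tapes 5
    S ls rs acc = X ∷ O ∷ word [] ls rs ∷ word JA [] (ones v) ∷ word JB acc [] ∷ []

-- Printing a text

horner : Polynomial → Program 5
horner []       = emit 3F []
horner (c ∷ cs) = horner cs ▹ hornerStep c

hornerCost : Polynomial → ℕ → ℕ
hornerCost []       n = 1
hornerCost (c ∷ cs) n =
  hornerCost cs n + hornerStepCost n c (evalPoly cs n)

horner-exec : ∀ X O n q → ∃[ JA ] ∃[ JB ]
  Exec (horner q) (hornerState X O n 0 [] []) (hornerState X O n (evalPoly q n) JA JB)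
       (hornerCost q n)
horner-exec X O n []       = [] , [] , emit-exec 3F [] _ [] [] refl
horner-exec X O n (c ∷ cs) with horner-exec X O n cs
... | JA , JB , e with hornerStep-exec X O n c (evalPoly cs n) JA JB
...   | JA′ , JB′ , e′ = JA′ , JB′ ,
  Exec-≡ refl (cong (λ v → hornerState X O n v JA′ JB′) (ℕ.+-comm _ c)) (▹-exec e e′)

-- The number of repetitions is the common length m of the work tapes A and B.
data Block : Set where
  once  : Word → Block
  line  : Word → Bool → Block
  lines : Word → Bool → Block
  input : Word → Word → Word → Block

repeat : ℕ → Word → Word
repeat k w = concat (replicate k w)

lineText : ℕ → Word → Bool → Word
lineText m w b = w ++ replicate m b

blockText : Word → ℕ → Block → Word
blockText x m (once w)    = w
blockText x m (line w b)  = lineText m w b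
blockText x m (lines w b) = repeat m (lineText m w b)
blockText x m (input w₁ w₀ w₋) =
  concatMap (λ b → lineText m (if b then w₁ else w₀) false) x
    ++ repeat (m ∸ length x) (lineText m w₋ false)

text : Word → ℕ → List Block → Word
text x m = concatMap (blockText x m)

fillStep : Bool → Vec Edit 5
fillStep b = keep ∷ put b ∷ keep ∷ go right ∷ keep ∷ []

printLine : Word → Bool → Program 5
printLine w b = emit 1F w ▹ while 3F (act (fillStep b)) ▹ rewind 3F

nextRow : Vec Edit 5
nextRow = go right ∷ keep ∷ keep ∷ keep ∷ go right ∷ []

printBlock : Block → Program 5
printBlock (once w)    = emit 1F w
printBlock (line w b)  = printLine w b
printBlock (lines w b) = while 4F (printLine w b ▹ shift 4F right) ▹ rewind 4F
printBlock (input w₁ w₀ w₋) =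
    -- `nextRow` advances B together with the input tape, so for an input of length at most m the
    -- second loop finds exactly `m ∸ length x` bits of B ahead.
    while 0F (ifOne 0F (printLine w₁ false) (printLine w₀ false) ▹ act nextRow)
  ▹ while 4F (printLine w₋ false ▹ shift 4F right)
  ▹ rewind 4F
  ▹ rewind 0F

printBlocks : List Block → Program 5
printBlocks []       = emit 1F []
printBlocks (b ∷ bs) = printBlock b ▹ printBlocks bs

lineCost : ℕ → Word → ℕ
lineCost m w = suc (length w) + (suc (m * 2) + rewindCost m)

blockCost : ℕ → ℕ → Block → ℕ
blockCost n m (once w)    = suc (length w)
blockCost n m (line w b)  = lineCost m w
blockCost n m (lines w b) = suc (m * suc (lineCost m w + 1)) + rewindCost m
blockCost n m (input w₁ w₀ w₋) =
  suc (n * suc (suc (lineCost m w₁ + lineCost m w₀) + 1))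
    + (suc (m * suc (lineCost m w₋ + 1)) + (rewindCost m + rewindCost n))

blocksCost : ℕ → ℕ → List Block → ℕ
blocksCost n m []       = 1
blocksCost n m (b ∷ bs) = blockCost n m b + blocksCost n m bs

concatMap-const : ∀ m (w : Word) → concatMap (λ _ → w) (ones m) ≡ repeat m w
concatMap-const zero    w = refl
concatMap-const (suc m) w = cong (w ++_) (concatMap-const m w)

repeat-bit : ∀ m (b : Bool) → repeat m (b ∷ []) ≡ replicate m b
repeat-bit zero    b = refl
repeat-bit (suc m) b = cong (b ∷_) (repeat-bit m b)

ones-ʳ++ : ∀ m n → ones m ʳ++ ones n ≡ ones (m + n)
ones-ʳ++ zero    n = refl
ones-ʳ++ (suc m) n = trans (ones-ʳ++ m (suc n)) (cong ones (ℕ.+-suc m n))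

module _ (C : Tape Cell) (JA : List Cell) (m : ℕ) where

  page : Tape Cell → Tape Cell → Word → Tapes 5
  page X B acc = X ∷ word [] acc [] ∷ C ∷ word JA [] (ones m) ∷ B ∷ []

  printLine-exec : ∀ w b X B acc →
    Exec (printLine w b) (page X B acc) (page X B (lineText m w b ʳ++ acc)) (lineCost m w)
  printLine-exec w b X B acc =
    Exec-≡ refl (cong (page X B) (sym (List.++-ʳ++ w)))
    (▹-exec (emit-exec 1F w _ [] acc refl)
    (▹-exec
      (Exec-≤ (ℕ.≤-reflexive (cong (λ l → suc (l * 2)) (List.length-replicate m)))
        (Exec-≡ refl (cong (λ v → S (ones m ʳ++ []) [] (v ʳ++ (w ʳ++ acc)))
                           (trans (concatMap-const m (b ∷ [])) (repeat-bit m b)))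
          (while-word S (λ _ → b ∷ []) (λ _ _ _ _ → refl) (λ _ _ → refl)
            (λ ls c rs acc → Exec-≡ refl (cong (λ t → _ ∷ _ ∷ _ ∷ t ∷ _ ∷ []) (right-word JA ls c rs))
              (act-exec (fillStep b) _))
            [] (ones m) (w ʳ++ acc))))
      (rewind-ones _ JA m refl)))
    where
    S : (ls rs acc : List Bool) → Tapes 5
    S ls rs acc = X ∷ word [] acc [] ∷ C ∷ word JA ls rs ∷ B ∷ []

  lines-exec : ∀ w b X JB ls k acc →
    Exec (while 4F (printLine w b ▹ shift 4F right))
         (page X (word JB ls (ones k)) acc)
         (page X (word JB (ones k ʳ++ ls) []) (repeat k (lineText m w b) ʳ++ acc))
         (suc (k * suc (lineCost m w + 1)))
  lines-exec w b X JB ls k acc =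
    Exec-≤ (ℕ.≤-reflexive (cong (λ l → suc (l * suc (lineCost m w + 1))) (List.length-replicate k)))
      (Exec-≡ refl (cong (λ v → S (ones k ʳ++ ls) [] (v ʳ++ acc)) (concatMap-const k (lineText m w b)))
        (while-word S (λ _ → lineText m w b) (λ _ _ _ _ → refl) (λ _ _ → refl)
          (λ ls c rs acc → ▹-exec (printLine-exec w b X (word JB ls (c ∷ rs)) acc)
            (only-exec 4F (go right) (S ls (c ∷ rs) _) refl (right-word JB ls c rs)))
          ls (ones k) acc))
    where
    S : (ls rs acc : List Bool) → Tapes 5
    S ls rs acc = page X (word JB ls rs) acc

  module _ (x : Word) (n≤m : length x ≤ m) (JB : List Cell) where

    private
      n = length x
      d = m ∸ n
      X = word [] [] x
      B = word JB [] (ones m)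

    input-exec : ∀ w₁ w₀ w₋ acc →
      Exec (printBlock (input w₁ w₀ w₋)) (page X B acc)
           (page X B (blockText x m (input w₁ w₀ w₋) ʳ++ acc))
           (blockCost n m (input w₁ w₀ w₋))
    input-exec w₁ w₀ w₋ acc =
      Exec-≡ (cong (λ v → page X (word JB [] v) acc)
                   (trans (cong (_++ ones d) (ones-length x))
                          (trans (ones-+ n d) (cong ones (ℕ.m+[n∸m]≡n n≤m)))))
             (cong (page X B) (sym (List.++-ʳ++ (concatMap row x))))
      (▹-exec (while-word S row (λ _ _ _ _ → refl) (λ _ _ → refl) body [] x acc)
      (▹-exec
        (Exec-≤ (s≤s (ℕ.*-monoˡ-≤ _ (ℕ.m∸n≤m m n)))
          (Exec-≡ refl (cong (λ v → page (word [] (x ʳ++ []) []) (word JB v []) acc₂) full)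
            (lines-exec w₋ false (word [] (x ʳ++ []) []) JB (ticks (x ʳ++ [])) d acc₁)))
      (▹-exec (rewind-ones (page (word [] (x ʳ++ []) []) _ acc₂) JB m refl)
              (rewind-exec (page (word [] (x ʳ++ []) []) B acc₂) [] x refl))))
      where
      row : Bool → Word
      row b = lineText m (if b then w₁ else w₀) false
      ticks : Word → Word
      ticks = concatMap (λ _ → true ∷ [])
      acc₁ = concatMap row x ʳ++ acc
      acc₂ = repeat d (lineText m w₋ false) ʳ++ acc₁
      full : ones d ʳ++ ticks (x ʳ++ []) ≡ ones m ʳ++ []
      full = begin
        ones d ʳ++ ticks (x ʳ++ [])      ≡⟨ cong (ones d ʳ++_) (ones-length (x ʳ++ [])) ⟩
        ones d ʳ++ ones (length (x ʳ++ [])) ≡⟨ ones-ʳ++ d _ ⟩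
        ones (d + length (x ʳ++ []))     ≡⟨ cong (λ l → ones (d + l)) (trans (List.length-ʳ++ x) (ℕ.+-identityʳ n)) ⟩
        ones (d + n)                     ≡⟨ cong ones (trans (ℕ.m∸n+n≡m n≤m) (sym (ℕ.+-identityʳ m))) ⟩
        ones (m + 0)                     ≡⟨ sym (ones-ʳ++ m 0) ⟩
        ones m ʳ++ []                    ∎
        where open ≡-Reasoning
      S : (ls rs acc : List Bool) → Tapes 5
      S ls rs acc = page (word [] ls rs) (word JB (ticks ls) (ticks rs ++ ones d)) acc
      branch : ∀ b {X B acc} →
        Exec (if b then printLine w₁ false else printLine w₀ false) (page X B acc) (page X B (row b ʳ++ acc))
             (lineCost m w₁ + lineCost m w₀)
      branch true  = Exec-≤ (ℕ.m≤m+n (lineCost m w₁) _) (printLine-exec w₁ false _ _ _)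
      branch false = Exec-≤ (ℕ.m≤n+m _ (lineCost m w₁)) (printLine-exec w₀ false _ _ _)
      body : ∀ ls b rs acc →
        Exec (ifOne 0F (printLine w₁ false) (printLine w₀ false) ▹ act nextRow)
             (S ls (b ∷ rs) acc) (S (b ∷ ls) rs (row b ʳ++ acc)) (suc (lineCost m w₁ + lineCost m w₀) + 1)
      body ls b rs acc =
        ▹-exec (ifOne-exec b refl (branch b))
          (Exec-≡ refl (cong₂ (λ t u → t ∷ _ ∷ _ ∷ _ ∷ u ∷ []) (right-word [] ls b rs)
                                (right-word JB (ticks ls) true (ticks rs ++ ones d)))
            (act-exec nextRow _))

    printBlock-exec : ∀ k acc → Exec (printBlock k) (page X B acc) (page X B (blockText x m k ʳ++ acc))
                                     (blockCost n m k)
    printBlock-exec (once w)         acc = emit-exec 1F w _ [] acc refl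
    printBlock-exec (line w b)       acc = printLine-exec w b X B acc
    printBlock-exec (lines w b)      acc =
      ▹-exec (lines-exec w b X JB [] m acc) (rewind-ones (page X _ _) JB m refl)
    printBlock-exec (input w₁ w₀ w₋) acc = input-exec w₁ w₀ w₋ acc

    printBlocks-exec : ∀ ks acc → Exec (printBlocks ks) (page X B acc) (page X B (text x m ks ʳ++ acc))
                                       (blocksCost n m ks)
    printBlocks-exec []       acc = emit-exec 1F [] _ [] acc refl
    printBlocks-exec (k ∷ ks) acc =
      Exec-≡ refl (cong (page X B) (sym (List.++-ʳ++ (blockText x m k))))
        (▹-exec (printBlock-exec k acc) (printBlocks-exec ks (blockText x m k ʳ++ acc)))

-- Polynomial running time

_⊞_ : Polynomial → Polynomial → Polynomial
[]      ⊞ q       = q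
(c ∷ p) ⊞ []      = c ∷ p
(c ∷ p) ⊞ (d ∷ q) = (c + d) ∷ (p ⊞ q)

_⊡_ : Polynomial → Polynomial → Polynomial
[]      ⊡ q = []
(c ∷ p) ⊡ q = map (c *_) q ⊞ (0 ∷ (p ⊡ q))

eval-⊞ : ∀ p q n → evalPoly (p ⊞ q) n ≡ evalPoly p n + evalPoly q n
eval-⊞ []      q       n = refl
eval-⊞ (c ∷ p) []      n = sym (ℕ.+-identityʳ _)
eval-⊞ (c ∷ p) (d ∷ q) n =
  trans (cong (λ e → c + d + n * e) (eval-⊞ p q n)) (rearrange c d n (evalPoly p n) (evalPoly q n))
  where
  rearrange : ∀ c d n a b → c + d + n * (a + b) ≡ (c + n * a) + (d + n * b)
  rearrange = solve-∀

eval-scale : ∀ c q n → evalPoly (map (c *_) q) n ≡ c * evalPoly q n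
eval-scale c []      n = sym (ℕ.*-zeroʳ c)
eval-scale c (d ∷ q) n =
  trans (cong (λ e → c * d + n * e) (eval-scale c q n)) (rearrange c d n (evalPoly q n))
  where
  rearrange : ∀ c d n a → c * d + n * (c * a) ≡ c * (d + n * a)
  rearrange = solve-∀

eval-⊡ : ∀ p q n → evalPoly (p ⊡ q) n ≡ evalPoly p n * evalPoly q n
eval-⊡ []      q n = refl
eval-⊡ (c ∷ p) q n =
  trans (eval-⊞ (map (c *_) q) (0 ∷ (p ⊡ q)) n)
  (trans (cong₂ (λ a b → a + n * b) (eval-scale c q n) (eval-⊡ p q n))
         (rearrange c n (evalPoly p n) (evalPoly q n)))
  where
  rearrange : ∀ c n a b → c * b + n * (a * b) ≡ (c + n * a) * b
  rearrange = solve-∀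

PolyBounded : (ℕ → ℕ) → Set
PolyBounded f = Σ[ p ∈ Polynomial ] (∀ n → f n ≤ evalPoly p n)

pb-eval : ∀ p → PolyBounded (evalPoly p)
pb-eval p = p , λ n → ℕ.≤-refl

pb-const : ∀ c → PolyBounded (λ _ → c)
pb-const c = c ∷ [] , λ n → ℕ.m≤m+n c _

pb-id : PolyBounded id
pb-id = 0 ∷ 1 ∷ [] , λ n → ℕ.≤-reflexive (identity n)
  where
  identity : ∀ n → n ≡ n * (1 + n * 0)
  identity = solve-∀

_pb+_ : ∀ {f g} → PolyBounded f → PolyBounded g → PolyBounded (λ n → f n + g n)
(p , f≤) pb+ (q , g≤) = p ⊞ q , λ n →
  ℕ.≤-trans (ℕ.+-mono-≤ (f≤ n) (g≤ n)) (ℕ.≤-reflexive (sym (eval-⊞ p q n)))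

_pb*_ : ∀ {f g} → PolyBounded f → PolyBounded g → PolyBounded (λ n → f n * g n)
(p , f≤) pb* (q , g≤) = p ⊡ q , λ n →
  ℕ.≤-trans (ℕ.*-mono-≤ (f≤ n) (g≤ n)) (ℕ.≤-reflexive (sym (eval-⊡ p q n)))

module _ {w : ℕ} (p : Program (2 + w)) {f : Word → Word} {b : ℕ → ℕ} (bounded : PolyBounded b)
  (exec : ∀ x → ∃[ ts ] (Exec p (inputTape x ∷ Vec.replicate (1 + w) emptyTape) ts (b (length x))
                          × tapeWord (lookup ts 1F) ≡ f x)) where

  open TM (compile p) using (RunsInTime; Computes)

  exec-polyTime : PolyTime f
  exec-polyTime = compile p , proj₁ bounded , compile-deterministic p , inTime , computes
    where
    inTime : RunsInTime (evalPoly (proj₁ bounded))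
    inTime x k c r with exec x
    ... | _ , (n , n≤ , reach) , _ = ℕ.≤-trans
      (run-≤-halting (compile p) (compile-deterministic p) (compile-run p reach) refl r)
      (ℕ.≤-trans n≤ (proj₂ bounded (length x)))
    computes : Computes f
    computes x with exec x
    ... | _ , (n , _ , reach) , out = n , _ , compile-run p reach , refl , out

pb-suc : ∀ {f} → PolyBounded f → PolyBounded (λ n → suc (f n))
pb-suc f = pb-const 1 pb+ f

infixr 6 _pb+_
infixr 7 _pb*_

pb-rewind : ∀ {f} → PolyBounded f → PolyBounded (λ n → rewindCost (f n))
pb-rewind f = pb-suc (pb-suc (f pb* pb-const 2) pb+ pb-const 1)

pb-skip : ∀ {f} → PolyBounded f → PolyBounded (λ n → suc (f n * 2))
pb-skip f = pb-suc (f pb* pb-const 2)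

pb-horner : ∀ q → PolyBounded (hornerCost q)
pb-horner []       = pb-const 1
pb-horner (c ∷ cs) =
  pb-horner cs pb+
  (pb-suc (pb-id pb* pb-suc ((pb-skip v pb+ pb-rewind v) pb+ pb-const 1)) pb+
   (pb-rewind pb-id pb+ (pb-const (suc c) pb+ (pb-skip v pb+ (pb-const 1 pb+
   (pb-rewind v′ pb+ (pb-skip v′ pb+ (pb-const 1 pb+ pb-rewind v′))))))))
  where
  v = pb-eval cs
  v′ = (pb-id pb* v) pb+ pb-const c

length-repeat : ∀ k w → length (repeat k w) ≡ k * length w
length-repeat zero    w = refl
length-repeat (suc k) w = trans (List.length-++ w) (cong (λ l → length w + l) (length-repeat k w))

lineText-length : ∀ m w b → length (lineText m w b) ≤ lineCost m w
lineText-length m w b = begin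
  length (w ++ replicate m b)       ≡⟨ List.length-++ w ⟩
  length w + length (replicate m b) ≡⟨ cong (λ l → length w + l) (List.length-replicate m) ⟩
  length w + m                      ≤⟨ ℕ.+-mono-≤ (ℕ.n≤1+n _) (ℕ.m≤n⇒m≤n+o _ (ℕ.m≤n⇒m≤1+n (ℕ.m≤m*n m 2))) ⟩
  lineCost m w                      ∎
  where open ℕ.≤-Reasoning

repeat-length : ∀ k m w b → length (repeat k (lineText m w b)) ≤ k * suc (lineCost m w + 1)
repeat-length k m w b = ℕ.≤-trans (ℕ.≤-reflexive (length-repeat k _))
  (ℕ.*-monoʳ-≤ k (ℕ.m≤n⇒m≤1+n (ℕ.m≤n⇒m≤n+o 1 (lineText-length m w b))))

concatMap-length : ∀ (f : Bool → Word) c → (∀ b → length (f b) ≤ c) →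
                   ∀ x → length (concatMap f x) ≤ length x * c
concatMap-length f c f≤ []       = z≤n
concatMap-length f c f≤ (b ∷ x) = ℕ.≤-trans (ℕ.≤-reflexive (List.length-++ (f b)))
  (ℕ.+-mono-≤ (f≤ b) (concatMap-length f c f≤ x))

-- Every printed bit takes at least one step. The cost of printing thus bounds the length of the
-- text, and with it the cost of rewinding the output tape at the end.
blockText-length : ∀ x m k → length (blockText x m k) ≤ blockCost (length x) m k
blockText-length x m (once w)    = ℕ.n≤1+n _
blockText-length x m (line w b)  = lineText-length m w b
blockText-length x m (lines w b) =
  ℕ.m≤n⇒m≤n+o _ (ℕ.m≤n⇒m≤1+n (repeat-length m m w b))
blockText-length x m (input w₁ w₀ w₋) = ℕ.≤-trans
  (ℕ.≤-reflexive (List.length-++ (concatMap row x)))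
  (ℕ.+-mono-≤
    (ℕ.m≤n⇒m≤1+n (concatMap-length row _ row≤ x))
    (ℕ.m≤n⇒m≤n+o _ (ℕ.m≤n⇒m≤1+n (ℕ.≤-trans (repeat-length (m ∸ length x) m w₋ false)
      (ℕ.*-monoˡ-≤ _ (ℕ.m∸n≤m m (length x)))))))
  where
  row : Bool → Word
  row b = lineText m (if b then w₁ else w₀) false
  row≤ : ∀ b → length (row b) ≤ suc (suc (lineCost m w₁ + lineCost m w₀) + 1)
  row≤ true  = ℕ.m≤n⇒m≤1+n (ℕ.m≤n⇒m≤n+o 1 (ℕ.m≤n⇒m≤1+n (ℕ.m≤n⇒m≤n+o _ (lineText-length m w₁ false))))
  row≤ false = ℕ.m≤n⇒m≤1+n (ℕ.m≤n⇒m≤n+o 1 (ℕ.m≤n⇒m≤1+n (ℕ.m≤n⇒m≤o+n (lineCost m w₁) (lineText-length m w₀ false))))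

text-length : ∀ x m ks → length (text x m ks) ≤ blocksCost (length x) m ks
text-length x m []       = z≤n
text-length x m (k ∷ ks) = ℕ.≤-trans (ℕ.≤-reflexive (List.length-++ (blockText x m k)))
  (ℕ.+-mono-≤ (blockText-length x m k) (text-length x m ks))

leadingBits-load : ∀ w → tapeWord (word [] [] w) ≡ w
leadingBits-load []       = refl
leadingBits-load (b ∷ w) = cong (b ∷_) (tail w)
  where
  tail : ∀ w → leadingBits (map bit w ++ blank ∷ []) ≡ w
  tail []       = refl
  tail (b ∷ w) = cong (b ∷_) (tail w)

module _ (q : Polynomial) where

  private
    m = pb-eval q

  pb-line : ∀ w → PolyBounded (λ n → lineCost (evalPoly q n) w)
  pb-line w = pb-const (suc (length w)) pb+ (pb-skip m pb+ pb-rewind m)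

  pb-block : ∀ k → PolyBounded (λ n → blockCost n (evalPoly q n) k)
  pb-block (once w)    = pb-const (suc (length w))
  pb-block (line w b)  = pb-line w
  pb-block (lines w b) = pb-suc (m pb* pb-suc (pb-line w pb+ pb-const 1)) pb+ pb-rewind m
  pb-block (input w₁ w₀ w₋) =
    pb-suc (pb-id pb* pb-suc (pb-suc (pb-line w₁ pb+ pb-line w₀) pb+ pb-const 1)) pb+
    (pb-suc (m pb* pb-suc (pb-line w₋ pb+ pb-const 1)) pb+ (pb-rewind m pb+ pb-rewind pb-id))

  pb-blocks : ∀ ks → PolyBounded (λ n → blocksCost n (evalPoly q n) ks)
  pb-blocks []       = pb-const 1
  pb-blocks (k ∷ ks) = pb-block k pb+ pb-blocks ks

  printer : List Block → Program 5
  -- After `horner` only A holds the m marks. Copying them to B gives two counters for the nested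
  -- loops, A within a line and B for the lines.
  printer ks = prepare ▹ horner q ▹ addA ▹ rewind 4F ▹ printBlocks ks ▹ rewind 1F

  module _ (n≤q : ∀ n → n ≤ evalPoly q n) (ks : List Block) where

    printerCost : Word → ℕ
    printerCost x =
      let n = length x ; v = evalPoly q n in
      prepareCost n + (hornerCost q n + ((suc (v * 2) + rewindCost v) + (rewindCost v +
      (blocksCost n v ks + rewindCost (length (text x v ks))))))

    printer-exec : ∀ x → ∃[ X ] ∃[ C ] ∃[ A ] ∃[ B ]
      Exec (printer ks) (inputTape x ∷ Vec.replicate 4 emptyTape)
           (X ∷ word [] [] (text x (evalPoly q (length x)) ks) ∷ C ∷ A ∷ B ∷ []) (printerCost x)
    printer-exec x with horner-exec (word [] [] x) (word [] [] []) (length x) q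
    ... | JA , JB , e = _ , _ , _ , _ ,
      ▹-exec (prepare-exec x) (▹-exec e
      (▹-exec (addA-exec X O n (word [] [] (ones n)) v JA JB [])
      (▹-exec (rewind-ones _ JB v refl)
      (▹-exec (printBlocks-exec (word [] [] (ones n)) JA v x (n≤q n) JB ks [])
              (rewind-exec _ [] (text x v ks) refl)))))
      where
      X = word [] [] x
      O = word [] [] []
      n = length x
      v = evalPoly q n

    printerBound : ℕ → ℕ
    printerBound n =
      let v = evalPoly q n ; c = blocksCost n v ks in
      prepareCost n + (hornerCost q n + ((suc (v * 2) + rewindCost v) + (rewindCost v +
      (c + rewindCost c))))

    pb-prepare : PolyBounded prepareCost
    pb-prepare = pb-const 1 pb+ (pb-const 1 pb+
      (pb-skip pb-id pb+ (pb-rewind pb-id pb+ pb-rewind pb-id)))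

    pb-printer : PolyBounded printerBound
    pb-printer = pb-prepare pb+ (pb-horner q pb+ ((pb-skip m pb+ pb-rewind m) pb+
      (pb-rewind m pb+ (pb-blocks ks pb+ pb-rewind (pb-blocks ks)))))

    rewindCost-mono : ∀ {a b} → a ≤ b → rewindCost a ≤ rewindCost b
    rewindCost-mono a≤b = s≤s (s≤s (ℕ.+-monoˡ-≤ 1 (ℕ.*-monoˡ-≤ 2 a≤b)))

    printerCost-≤ : ∀ x → printerCost x ≤ printerBound (length x)
    printerCost-≤ x = let n = length x ; v = evalPoly q n in
      ℕ.+-monoʳ-≤ (prepareCost n) (ℕ.+-monoʳ-≤ (hornerCost q n)
        (ℕ.+-monoʳ-≤ (suc (v * 2) + rewindCost v) (ℕ.+-monoʳ-≤ (rewindCost v)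
        (ℕ.+-monoʳ-≤ (blocksCost n v ks) (rewindCost-mono (text-length x v ks))))))

    text-polyTime : PolyTime (λ x → text x (evalPoly q (length x)) ks)
    text-polyTime = exec-polyTime (printer ks) pb-printer prints
      where
      prints : ∀ x → ∃[ ts ]
        (Exec (printer ks) (inputTape x ∷ Vec.replicate 4 emptyTape) ts (printerBound (length x))
          × tapeWord (lookup ts 1F) ≡ text x (evalPoly q (length x)) ks)
      prints x with printer-exec x
      ... | _ , _ , _ , _ , e = _ , Exec-≤ (printerCost-≤ x) e ,
        leadingBits-load (text x (evalPoly q (length x)) ks)

-- Tiles

-- A retract of a finite set is enough: the relations see a code only through `dec`, so several
-- codes for one element do no harm.
record Coded (X : Set) : Set where
  field
    card    : ℕ
    enc     : X → Fin card
    dec     : Fin card → X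
    dec-enc : ∀ x → dec (enc x) ≡ x

open Coded

coded-≟ : ∀ {X} → Coded X → DecidableEquality X
coded-≟ C x y = map′
  (λ e → trans (sym (dec-enc C x)) (trans (cong (dec C) e) (dec-enc C y)))
  (cong (enc C)) (enc C x Fin.≟ enc C y)

coded-finite : ∀ {X} → Finite X → Coded X
coded-finite (n , e) = record
  { card = n ; enc = Inverse.to e ; dec = Inverse.from e ; dec-enc = Inverse.strictlyInverseʳ e }

coded-retract : ∀ {X Y} (f : X → Y) (g : Y → X) → (∀ x → g (f x) ≡ x) → Coded Y → Coded X
coded-retract f g gf C = record
  { card = card C ; enc = enc C ∘ f ; dec = g ∘ dec C
  ; dec-enc = λ x → trans (cong g (dec-enc C (f x))) (gf x) }

coded-Fin : ∀ n → Coded (Fin n)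
coded-Fin n = record { card = n ; enc = id ; dec = id ; dec-enc = λ _ → refl }

coded-⊤ : Coded ⊤
coded-⊤ = coded-retract (λ _ → zero) _ (λ _ → refl) (coded-Fin 1)

coded-⊎ : ∀ {X Y} → Coded X → Coded Y → Coded (X ⊎ Y)
coded-⊎ C D = record
  { card = card C + card D
  ; enc = λ z → join (card C) (card D) ([ inj₁ ∘ enc C , inj₂ ∘ enc D ]′ z)
  ; dec = λ i → [ inj₁ ∘ dec C , inj₂ ∘ dec D ]′ (splitAt (card C) i)
  ; dec-enc = λ
    { (inj₁ x) → trans (cong [ inj₁ ∘ dec C , inj₂ ∘ dec D ]′ (Fin.splitAt-join (card C) (card D) (inj₁ (enc C x))))
                       (cong inj₁ (dec-enc C x))
    ; (inj₂ y) → trans (cong [ inj₁ ∘ dec C , inj₂ ∘ dec D ]′ (Fin.splitAt-join (card C) (card D) (inj₂ (enc D y))))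
                       (cong inj₂ (dec-enc D y)) } }

coded-× : ∀ {X Y} → Coded X → Coded Y → Coded (X × Y)
coded-× C D = record
  { card = card C * card D
  ; enc = λ (x , y) → combine (enc C x) (enc D y)
  ; dec = λ i → let (a , b) = remQuot (card D) i in dec C a , dec D b
  ; dec-enc = λ (x , y) → trans
      (cong (λ (a , b) → dec C a , dec D b) (Fin.remQuot-combine (enc C x) (enc D y)))
      (cong₂ _,_ (dec-enc C x) (dec-enc D y)) }

coded-Vec : ∀ {X} k → Coded X → Coded (Vec X k)
coded-Vec zero    C = coded-retract (λ _ → tt) (λ _ → []) (λ { [] → refl }) coded-⊤
coded-Vec (suc k) C = coded-retract (λ { (x ∷ v) → x , v }) (λ (x , v) → x ∷ v)
  (λ { (x ∷ v) → refl }) (coded-× C (coded-Vec k C))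

coded-Bool : Coded Bool
coded-Bool = coded-retract (λ { false → zero ; true → suc zero })
  (λ { zero → false ; (suc _) → true }) (λ { false → refl ; true → refl }) (coded-Fin 2)

coded-Maybe : ∀ {X} → Coded X → Coded (Maybe X)
coded-Maybe C = coded-retract (λ { nothing → inj₁ tt ; (just x) → inj₂ x })
  (λ { (inj₁ _) → nothing ; (inj₂ x) → just x }) (λ { nothing → refl ; (just x) → refl })
  (coded-⊎ coded-⊤ C)

coded-Move : Coded Move
coded-Move = coded-retract
  (λ { left → zero ; stay → suc zero ; right → suc (suc zero) })
  (λ { zero → left ; (suc zero) → stay ; (suc (suc _)) → right })
  (λ { left → refl ; stay → refl ; right → refl }) (coded-Fin 3)

coded-Symbol : ∀ {Aux} → Coded Aux → Coded (Symbol Aux)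
coded-Symbol C = coded-retract
  (λ { blank → inj₁ tt ; (bit b) → inj₂ (inj₁ b) ; (aux a) → inj₂ (inj₂ a) })
  (λ { (inj₁ _) → blank ; (inj₂ (inj₁ b)) → bit b ; (inj₂ (inj₂ a)) → aux a })
  (λ { blank → refl ; (bit b) → refl ; (aux a) → refl })
  (coded-⊎ coded-⊤ (coded-⊎ coded-Bool C))

-- Tape contents at signed distances from the heads

prev next : ℤ → ℤ
prev (+ zero)     = -[1+ 0 ]
prev (+ suc n)    = + n
prev -[1+ n ]     = -[1+ suc n ]
next (+ n)        = + suc n
next -[1+ zero ]  = + 0
next -[1+ suc n ] = -[1+ n ]

next-prev : ∀ z → next (prev z) ≡ z
next-prev (+ zero)  = refl
next-prev (+ suc n) = refl
next-prev -[1+ n ]  = refl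

prev-next : ∀ z → prev (next z) ≡ z
prev-next (+ n)        = refl
prev-next -[1+ zero ]  = refl
prev-next -[1+ suc n ] = refl

∣prev∣≤ : ∀ z → ∣ prev z ∣ ≤ suc ∣ z ∣
∣prev∣≤ (+ zero)  = ℕ.≤-refl
∣prev∣≤ (+ suc n) = ℕ.m≤n⇒m≤1+n (ℕ.n≤1+n n)
∣prev∣≤ -[1+ n ]  = ℕ.≤-refl

∣next∣≤ : ∀ z → ∣ next z ∣ ≤ suc ∣ z ∣
∣next∣≤ (+ n)        = ℕ.≤-refl
∣next∣≤ -[1+ zero ]  = z≤n
∣next∣≤ -[1+ suc n ] = ℕ.m≤n⇒m≤1+n (ℕ.n≤1+n (suc n))

≤∣prev∣ : ∀ z → ∣ z ∣ ≤ suc ∣ prev z ∣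
≤∣prev∣ z = subst (λ y → ∣ y ∣ ≤ suc ∣ prev z ∣) (next-prev z) (∣next∣≤ (prev z))

≤∣next∣ : ∀ z → ∣ z ∣ ≤ suc ∣ next z ∣
≤∣next∣ z = subst (λ y → ∣ y ∣ ≤ suc ∣ next z ∣) (prev-next z) (∣prev∣≤ (next z))

atOrigin : ℤ → Bool
atOrigin (+ zero)  = true
atOrigin (+ suc n) = false
atOrigin -[1+ n ]  = false

letter : Word → ℕ → Maybe Bool
letter []      _       = nothing
letter (b ∷ x) zero    = just b
letter (b ∷ x) (suc i) = letter x i

letter-beyond : ∀ x i → length x ≤ i → letter x i ≡ nothing
letter-beyond []      i       _       = refl
letter-beyond (b ∷ x) (suc i) (s≤s p) = letter-beyond x i p

neighbour : ∀ {A : Set} → Move → A → A → A → A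
neighbour left  l m r = l
neighbour stay  l m r = m
neighbour right l m r = r

module _ {Aux : Set} where

  nth : List (Symbol Aux) → ℕ → Symbol Aux
  nth []       _       = blank
  nth (s ∷ ss) zero    = s
  nth (s ∷ ss) (suc i) = nth ss i

  at : Tape (Symbol Aux) → ℤ → Symbol Aux
  at t (+ zero)  = scanned t
  at t (+ suc i) = nth (after t) i
  at t -[1+ i ]  = nth (before t) i

  at-move : ∀ d t z → at (moveHead d t) z ≡ neighbour d (at t (prev z)) (at t z) (at t (next z))
  at-move stay  t                    z               = refl
  at-move left  (tape [] s rs)       (+ zero)        = refl
  at-move left  (tape [] s rs)       (+ suc zero)    = refl
  at-move left  (tape [] s rs)       (+ suc (suc i)) = refl
  at-move left  (tape [] s rs)       -[1+ i ]        = refl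
  at-move left  (tape (l ∷ ls) s rs) (+ zero)        = refl
  at-move left  (tape (l ∷ ls) s rs) (+ suc zero)    = refl
  at-move left  (tape (l ∷ ls) s rs) (+ suc (suc i)) = refl
  at-move left  (tape (l ∷ ls) s rs) -[1+ i ]        = refl
  at-move right (tape ls s [])       (+ zero)        = refl
  at-move right (tape ls s [])       (+ suc i)       = refl
  at-move right (tape ls s [])       -[1+ zero ]     = refl
  at-move right (tape ls s [])       -[1+ suc i ]    = refl
  at-move right (tape ls s (r ∷ rs)) (+ zero)        = refl
  at-move right (tape ls s (r ∷ rs)) (+ suc i)       = refl
  at-move right (tape ls s (r ∷ rs)) -[1+ zero ]     = refl
  at-move right (tape ls s (r ∷ rs)) -[1+ suc i ]    = refl

  symbol : Maybe Bool → Symbol Aux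
  symbol nothing  = blank
  symbol (just b) = bit b

  at-empty : ∀ z → at emptyTape z ≡ blank
  at-empty (+ zero)  = refl
  at-empty (+ suc i) = refl
  at-empty -[1+ i ]  = refl

  nth-bits : ∀ x i → nth (map bit x) i ≡ symbol (letter x i)
  nth-bits []      i       = refl
  nth-bits (b ∷ x) zero    = refl
  nth-bits (b ∷ x) (suc i) = nth-bits x i

  at-input : ∀ x i → at (inputTape x) (+ i) ≡ symbol (letter x i)
  at-input []      i       = at-empty (+ i)
  at-input (b ∷ x) zero    = refl
  at-input (b ∷ x) (suc i) = nth-bits x i

  at-input-left : ∀ x i → at (inputTape x) -[1+ i ] ≡ blank
  at-input-left []      i = refl
  at-input-left (b ∷ x) i = refl

  content : ∀ {k} → Vec (Tape (Symbol Aux)) k → ℤ → Vec (Symbol Aux) k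
  content ts z = Vec.map (λ t → at t z) ts

  overwrite : ∀ {k} → Vec (Symbol Aux × Move) k → Vec (Tape (Symbol Aux)) k → Vec (Tape (Symbol Aux)) k
  overwrite = zipWith (λ w t → record t { scanned = proj₁ w })

  shifts : ∀ {k} → Vec (Symbol Aux × Move) k → (l m r : Vec (Symbol Aux) k) → Vec (Symbol Aux) k
  shifts []            []      []      []      = []
  shifts ((_ , d) ∷ ws) (l ∷ ls) (m ∷ ms) (r ∷ rs) = neighbour d l m r ∷ shifts ws ls ms rs

  -- The tapes move independently, but relative to its own head each tape shifts by at most one
  -- cell. A new column is thus assembled from three adjacent old ones; this locality is the reason
  -- why a tile stores `l`, `c` and `r`.
  content-writeMove : ∀ {k} ws (ts : Vec (Tape (Symbol Aux)) k) z →
    content (zipWith writeMove ws ts) z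
      ≡ shifts ws (content (overwrite ws ts) (prev z)) (content (overwrite ws ts) z)
                  (content (overwrite ws ts) (next z))
  content-writeMove []             []       z = refl
  content-writeMove ((s , d) ∷ ws) (t ∷ ts) z =
    cong₂ _∷_ (at-move d (record t { scanned = s }) z) (content-writeMove ws ts z)

  overwrite-origin : ∀ {k} ws (ts : Vec (Tape (Symbol Aux)) k) →
    content (overwrite ws ts) (+ 0) ≡ Vec.map proj₁ ws
  overwrite-origin []       []       = refl
  overwrite-origin (w ∷ ws) (t ∷ ts) = cong (proj₁ w ∷_) (overwrite-origin ws ts)

  overwrite-off : ∀ {k} ws (ts : Vec (Tape (Symbol Aux)) k) z → atOrigin z ≡ false →
    content (overwrite ws ts) z ≡ content ts z
  overwrite-off []       []       z         _ = refl
  overwrite-off (w ∷ ws) (t ∷ ts) (+ suc i) e = cong (_ ∷_) (overwrite-off ws ts (+ suc i) e)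
  overwrite-off (w ∷ ws) (t ∷ ts) -[1+ i ]  e = cong (_ ∷_) (overwrite-off ws ts -[1+ i ] e)

  blanks : ∀ k → Vec (Symbol Aux) k
  blanks k = Vec.replicate k blank

  shifts-blanks : ∀ {k} (ws : Vec (Symbol Aux × Move) k) →
                  shifts ws (blanks k) (blanks k) (blanks k) ≡ blanks k
  shifts-blanks []                 = refl
  shifts-blanks ((_ , left)  ∷ ws) = cong (blank ∷_) (shifts-blanks ws)
  shifts-blanks ((_ , stay)  ∷ ws) = cong (blank ∷_) (shifts-blanks ws)
  shifts-blanks ((_ , right) ∷ ws) = cong (blank ∷_) (shifts-blanks ws)

cyclicPred : ∀ {n} → Fin (suc n) → Fin (suc n)
cyclicPred {n} zero    = fromℕ n
cyclicPred     (suc i) = inject₁ i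

isZero : ∀ {n} → Fin n → Bool
isZero zero    = true
isZero (suc _) = false

-- The tile set and its matching relations

module Tiles (M : TM) where
  open TM M

  Γ : Set
  Γ = Vec (Symbol Aux) tapes

  -- The state, the scanned symbols, and the action that is taken; a halting
  -- configuration has no action.
  Guess : Set
  Guess = State × Γ × Maybe Action

  -- A tile run g l c r describes the symbols c of one column of the tapes and
  -- those of the two neighbouring columns, after the action of g has written
  -- its symbols and before it moves the heads.  Columns are relative to the
  -- heads, so that moving a head shifts a tape.
  data Tile : Set where
    final : Tile
    init  : Maybe Bool → Tile
    run   : Guess → (l c r : Γ) → Tile

  coded-Sym : Coded (Symbol Aux)
  coded-Sym = coded-Symbol (coded-finite finite-Aux)

  coded-Γ : Coded Γ
  coded-Γ = coded-Vec tapes coded-Sym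

  coded-Action : Coded Action
  coded-Action = coded-× (coded-finite finite-State) (coded-Vec tapes (coded-× coded-Sym coded-Move))

  coded-Guess : Coded Guess
  coded-Guess = coded-× (coded-finite finite-State) (coded-× coded-Γ (coded-Maybe coded-Action))

  coded-Tile : Coded Tile
  coded-Tile = coded-retract to from (λ { final → refl ; (init b) → refl ; (run g l c r) → refl })
    (coded-⊎ coded-⊤ (coded-⊎ (coded-Maybe coded-Bool)
      (coded-× coded-Guess (coded-× coded-Γ (coded-× coded-Γ coded-Γ)))))
    where
    to : Tile → _
    to final         = inj₁ tt
    to (init b)      = inj₂ (inj₁ b)
    to (run g l c r) = inj₂ (inj₂ (g , l , c , r))
    from : _ → Tile
    from (inj₁ _)                       = final
    from (inj₂ (inj₁ b))                = init b
    from (inj₂ (inj₂ (g , l , c , r))) = run g l c r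

  -- Acceptance is enforced here: taking no action is allowed only at an accepting halt, so a
  -- rejecting branch cannot be tiled further.
  Legal : Guess → Set
  Legal (q , ss , nothing) = δ q ss ≡ [] × accepting q ≡ true
  Legal (q , ss , just a)  = a ∈ δ q ss

  written : Guess → Γ
  written (q , ss , nothing)       = ss
  written (q , ss , just (_ , ws)) = Vec.map proj₁ ws

  -- Only the column of the heads can check the guessed scanned symbols and receive the written
  -- ones. All other columns learn the guess through `Horizontal`.
  Column : Bool → Guess → Γ → Γ → Set
  Column true  g@(q , ss , a) s c = ss ≡ s × c ≡ written g
  Column false g              s c = c ≡ s

  Enter : Bool → State → Γ → Tile → Set
  Enter o q s final         = ⊥
  Enter o q s (init _)      = ⊥
  Enter o q s (run g l c r) = proj₁ g ≡ q × Legal g × Column o g s c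

  letterColumn : Maybe Bool → Γ
  letterColumn b = symbol b ∷ blanks _

  -- The pair `final`, `init` lets the last row meet the bottom row across the torus; no other tile
  -- may precede an `init`.
  Vertical : Bool → Tile → Tile → Set
  Vertical o final final        = ⊤
  Vertical o final (init _)     = ⊤
  Vertical o final (run _ _ _ _) = ⊥
  Vertical o (init b) t = Enter o start (letterColumn b) t
  Vertical o (run (q , ss , nothing) l c r) final         = ⊤
  Vertical o (run (q , ss , nothing) l c r) (init _)      = ⊥
  Vertical o (run (q , ss , nothing) l c r) (run _ _ _ _) = ⊥
  Vertical o (run (q , ss , just (q′ , ws)) l c r) t = Enter o q′ (shifts ws l c r) t

  Horizontal : Tile → Tile → Set
  Horizontal final         final             = ⊤
  Horizontal (init _)      (init _)          = ⊤
  Horizontal (run g l c r) (run g′ l′ c′ r′) = g ≡ g′ × c ≡ l′ × r ≡ c′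
  Horizontal _             _                 = ⊥

  legal? : ∀ g → Dec (Legal g)
  legal? (q , ss , nothing) = List.≡-dec (coded-≟ coded-Action) (δ q ss) [] ×-dec (accepting q Bool.≟ true)
  legal? (q , ss , just a)  = a ∈? δ q ss
    where open import Data.List.Membership.DecPropositional (coded-≟ coded-Action) using (_∈?_)

  enter? : ∀ o q s t → Dec (Enter o q s t)
  enter? o q s final    = no λ ()
  enter? o q s (init _) = no λ ()
  enter? o q s (run g l c r) =
    coded-≟ (coded-finite finite-State) (proj₁ g) q ×-dec (legal? g ×-dec column? o)
    where
    column? : ∀ o → Dec (Column o g s c)
    column? true  = coded-≟ coded-Γ _ s ×-dec coded-≟ coded-Γ c (written g)
    column? false = coded-≟ coded-Γ c s

  vertical? : ∀ o t u → Dec (Vertical o t u)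
  vertical? o final final         = yes tt
  vertical? o final (init _)      = yes tt
  vertical? o final (run _ _ _ _) = no λ ()
  vertical? o (init b) t = enter? o start (letterColumn b) t
  vertical? o (run (q , ss , nothing) l c r) final         = yes tt
  vertical? o (run (q , ss , nothing) l c r) (init _)      = no λ ()
  vertical? o (run (q , ss , nothing) l c r) (run _ _ _ _) = no λ ()
  vertical? o (run (q , ss , just (q′ , ws)) l c r) t = enter? o q′ (shifts ws l c r) t

  horizontal? : ∀ t u → Dec (Horizontal t u)
  horizontal? final         final             = yes tt
  horizontal? (init _)      (init _)          = yes tt
  horizontal? (run g l c r) (run g′ l′ c′ r′) =
    coded-≟ coded-Guess g g′ ×-dec (coded-≟ coded-Γ c l′ ×-dec coded-≟ coded-Γ r c′)
  horizontal? final         (init _)          = no λ ()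
  horizontal? final         (run _ _ _ _)     = no λ ()
  horizontal? (init _)      final             = no λ ()
  horizontal? (init _)      (run _ _ _ _)     = no λ ()
  horizontal? (run _ _ _ _) final             = no λ ()
  horizontal? (run _ _ _ _) (init _)          = no λ ()

  record Tiling {n} (x : Word) (τ : (t p : Fin (suc n)) → Tile) : Set where
    field
      bottom     : ∀ p → τ zero p ≡ init (letter x (toℕ p))
      horizontal : ∀ t p → Horizontal (τ t (cyclicPred p)) (τ t p)
      vertical   : ∀ t p → Vertical (isZero p) (τ (cyclicPred t) p) (τ t p)

  afterWriting : Vec (Tape (Symbol Aux)) tapes → Maybe Action → ℤ → Γ
  afterWriting ts nothing         = content ts
  afterWriting ts (just (_ , ws)) = content (overwrite ws ts)

  afterWriting-off : ∀ ts a z → atOrigin z ≡ false → afterWriting ts a z ≡ content ts z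
  afterWriting-off ts nothing         z e = refl
  afterWriting-off ts (just (_ , ws)) z e = overwrite-off ws ts z e

  scans : Config → Γ
  scans c = Vec.map scanned (contents c)

  afterWriting-origin : ∀ q ts a → afterWriting ts a (+ 0) ≡ written (q , Vec.map scanned ts , a)
  afterWriting-origin q ts nothing         = refl
  afterWriting-origin q ts (just (_ , ws)) = overwrite-origin ws ts

  content-initial : ∀ x b z → at (inputTape x) z ≡ symbol b →
                    letterColumn b ≡ content (contents (initial x)) z
  content-initial x b z e = cong₂ _∷_ (sym e)
    (sym (trans (Vecₚ.map-replicate _ emptyTape _) (cong (Vec.replicate _) (at-empty z))))

-- From tilings to accepting runs

clamp : ∀ n → ℕ → Fin (suc n)
clamp n       zero    = zero
clamp zero    (suc i) = zero
clamp (suc n) (suc i) = suc (clamp n i)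

toℕ-clamp : ∀ {n i} → i ≤ n → toℕ (clamp n i) ≡ i
toℕ-clamp z≤n     = refl
toℕ-clamp (s≤s p) = cong suc (toℕ-clamp p)

pred-clamp : ∀ {n i} → suc i ≤ n → cyclicPred (clamp n (suc i)) ≡ clamp n i
pred-clamp {suc n} {i} (s≤s p) = Fin.toℕ-injective
  (trans (Fin.toℕ-inject₁ (clamp n i)) (trans (toℕ-clamp p) (sym (toℕ-clamp (ℕ.m≤n⇒m≤1+n p)))))

pos : ∀ n → ℤ → Fin (suc n)
pos n (+ i)        = clamp n i
pos n -[1+ zero ]  = cyclicPred zero
pos n -[1+ suc i ] = cyclicPred (pos n -[1+ i ])

pred-pos : ∀ {n} z → ∣ z ∣ ≤ n → cyclicPred (pos n z) ≡ pos n (prev z)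
pred-pos (+ zero)  _ = refl
pred-pos (+ suc i) p = pred-clamp p
pred-pos -[1+ i ]  _ = refl

toℕ-cyclicPred : ∀ {n} (i : Fin (suc n)) {k} → toℕ i ≡ suc k → toℕ (cyclicPred i) ≡ k
toℕ-cyclicPred (suc i) e = trans (Fin.toℕ-inject₁ i) (ℕ.suc-injective e)

suc-∸ : ∀ {i n} → suc i ≤ n → n ∸ i ≡ suc (n ∸ suc i)
suc-∸ {zero}  (s≤s _) = refl
suc-∸ {suc i} (s≤s p) = suc-∸ p

toℕ-pos-left : ∀ n i → suc i ≤ suc n → toℕ (pos n -[1+ i ]) ≡ n ∸ i
toℕ-pos-left n zero    _       = Fin.toℕ-fromℕ n
toℕ-pos-left n (suc i) (s≤s p) = toℕ-cyclicPred (pos n -[1+ i ])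
  (trans (toℕ-pos-left n i (ℕ.m≤n⇒m≤1+n p)) (suc-∸ p))

isZero-toℕ : ∀ {n} (p : Fin n) {k} → toℕ p ≡ suc k → isZero p ≡ false
isZero-toℕ (suc p) _ = refl

isZero-pos : ∀ {n} z → ∣ z ∣ ≤ n → isZero (pos n z) ≡ atOrigin z
isZero-pos     (+ zero)        _       = refl
isZero-pos {suc n} (+ suc i)   p       = refl
isZero-pos {suc n} -[1+ i ]    (s≤s p) =
  isZero-toℕ (pos (suc n) -[1+ i ]) (trans (toℕ-pos-left (suc n) i (ℕ.m≤n⇒m≤1+n (s≤s p))) (ℕ.+-∸-assoc 1 p))

module Soundness (M : TM) where
  open TM M
  open Tiles M

  _▹▹_ : ∀ {k c d e} → Run k c d → Step d e → Run (suc k) c e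
  done    ▹▹ s = s ▸ done
  (t ▸ r) ▹▹ s = t ▸ (r ▹▹ s)

  horizontal-inv : ∀ {g l c r t} → Horizontal (run g l c r) t →
                   ∃[ r′ ] ∃[ c′ ] (t ≡ run g c c′ r′ × r ≡ c′)
  horizontal-inv {t = run _ _ _ _} (refl , refl , e) = _ , _ , refl , e

  horizontal-inv′ : ∀ {g l c r t} → Horizontal t (run g l c r) →
                    ∃[ l′ ] (t ≡ run g l′ l c)
  horizontal-inv′ {t = run _ _ _ _} (refl , refl , refl) = _ , refl

  enter-inv : ∀ {o q s t} → Enter o q s t →
              ∃[ g ] ∃[ l ] ∃[ c ] ∃[ r ] (t ≡ run g l c r × proj₁ g ≡ q × Legal g × Column o g s c)
  enter-inv {t = run g l c r} (e , lg , col) = g , l , c , r , refl , e , lg , col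

  run-injective : ∀ {g l c r g′ l′ c′ r′} → run g l c r ≡ run g′ l′ c′ r′ →
                  g ≡ g′ × l ≡ l′ × c ≡ c′ × r ≡ r′
  run-injective refl = refl , refl , refl , refl

  module _ {n} (row : Fin (suc n) → Tile) (hor : ∀ p → Horizontal (row (cyclicPred p)) (row p))
           (q : State) (ts : Vec (Tape (Symbol Aux)) tapes) where

    hor-pos : ∀ z → ∣ z ∣ ≤ n → Horizontal (row (pos n (prev z))) (row (pos n z))
    hor-pos z p = subst (λ y → Horizontal (row y) (row (pos n z))) (pred-pos z p) (hor (pos n z))

    Shows : Maybe Action → ℤ → Set
    Shows a z = ∃[ l ] ∃[ r ] (row (pos n z) ≡ run (q , Vec.map scanned ts , a) l (afterWriting ts a z) r)

    module _ (w : ℕ) (w≤n : w ≤ n)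
             (enters : ∀ z → ∣ z ∣ ≤ w → Enter (atOrigin z) q (content ts z) (row (pos n z))) where

      -- At the heads `Column true` pins the guessed symbols to the scanned ones. The action `a` is
      -- the one piece that is left to the tiling, and `Legal` makes it a possible one.
      shows-origin : ∃[ a ] (Legal (q , Vec.map scanned ts , a) × Shows a (+ 0))
      shows-origin with enter-inv (enters (+ 0) z≤n)
      ... | (_ , _ , a) , l , c , r , eq , refl , lg , refl , refl =
        a , lg , l , r , trans eq (cong (λ c → run (q , Vec.map scanned ts , a) l c r) (sym (afterWriting-origin q ts a)))

      shows-column : ∀ a z {g l c r} → atOrigin z ≡ false → ∣ z ∣ ≤ w →
                     row (pos n z) ≡ run g l c r → g ≡ (q , Vec.map scanned ts , a) → Shows a z
      shows-column a z {g} {l} {c} {r} e p eq refl with enter-inv (enters z p)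
      ... | g′ , l′ , c′ , r′ , eq′ , _ , _ , col with run-injective (trans (sym eq) eq′)
      ... | refl , refl , refl , refl = l , r ,
        trans eq (cong (λ c → run g l c r) (trans (subst (λ o → Column o g (content ts z) c) e col)
                                                  (sym (afterWriting-off ts a z e))))

      module _ (a : Maybe Action) (origin : Shows a (+ 0)) where

        shows-right : ∀ i → i ≤ w → Shows a (+ i)
        shows-right zero    _ = origin
        shows-right (suc i) p with shows-right i (ℕ.≤-trans (ℕ.n≤1+n i) p)
        ... | l , r , eq with horizontal-inv (subst (λ t → Horizontal t (row (pos n (+ suc i)))) eq
                                                    (hor-pos (+ suc i) (ℕ.≤-trans p w≤n)))
        ... | _ , _ , eq′ , _ = shows-column a (+ suc i) refl p eq′ refl

        shows-leftwards : ∀ z → ∣ prev z ∣ ≤ w → ∣ z ∣ ≤ w → atOrigin (prev z) ≡ false → Shows a z →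
                          Shows a (prev z)
        shows-leftwards z p p′ o (l , r , eq) with horizontal-inv′
          (subst (Horizontal (row (pos n (prev z)))) eq (hor-pos z (ℕ.≤-trans p′ w≤n)))
        ... | _ , eq′ = shows-column a (prev z) o p eq′ refl

        shows-left : ∀ i → suc i ≤ w → Shows a -[1+ i ]
        shows-left zero    p = shows-leftwards (+ 0) p z≤n refl origin
        shows-left (suc i) p = shows-leftwards -[1+ i ] p p′ refl (shows-left i p′)
          where p′ = ℕ.≤-trans (ℕ.n≤1+n (suc i)) p

        shows : ∀ z → ∣ z ∣ ≤ w → Shows a z
        shows (+ i)    p = shows-right i p
        shows -[1+ i ] p = shows-left i p

    -- The side components `l` and `r` are known only by comparison with the two adjacent tiles,
    -- which must lie in the window too. This is where the window loses one column on each side.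
    full-column : ∀ w a → suc w ≤ n → (∀ z → ∣ z ∣ ≤ suc w → Shows a z) → ∀ z → ∣ z ∣ ≤ w →
      row (pos n z) ≡ run (q , Vec.map scanned ts , a) (afterWriting ts a (prev z))
                          (afterWriting ts a z) (afterWriting ts a (next z))
    full-column w a w<n sh z p
      with sh z (ℕ.m≤n⇒m≤1+n p)
         | sh (prev z) (ℕ.≤-trans (∣prev∣≤ z) (s≤s p))
         | sh (next z) (ℕ.≤-trans (∣next∣≤ z) (s≤s p))
    ... | l , r , eq | lp , rp , eqp | ln , rn , eqn
      with subst₂ Horizontal eqp eq (hor-pos z (ℕ.≤-trans p (ℕ.≤-trans (ℕ.n≤1+n w) w<n)))
         | subst₂ Horizontal (trans (cong (row ∘ pos n) (prev-next z)) eq) eqn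
             (hor-pos (next z) (ℕ.≤-trans (∣next∣≤ z) (ℕ.≤-trans (s≤s p) w<n)))
    ... | _ , el , _ | _ , _ , er =
      trans eq (cong₂ (λ l r → run _ l (afterWriting ts a z) r) (sym el) er)

  module _ {n T x} (τ : (t p : Fin (suc n)) → Tile) (tiling : Tiling x τ)
           (bound : ∀ k c → Run k (initial x) c → k ≤ T) (large : length x + (2 + T) ≤ n) where
    open Tiling tiling

    private
      2+T≤n : 2 + T ≤ n
      2+T≤n = ℕ.m+n≤o⇒n≤o (length x) large

    EntersRow : ℕ → ℕ → Config → Set
    EntersRow j w c = ∀ z → ∣ z ∣ ≤ w →
      Enter (atOrigin z) (state c) (content (contents c) z) (τ (clamp n j) (pos n z))

    vertical-pos : ∀ j z → suc j ≤ n → ∣ z ∣ ≤ n →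
      Vertical (atOrigin z) (τ (clamp n j) (pos n z)) (τ (clamp n (suc j)) (pos n z))
    vertical-pos j z p p′ = subst₂ (λ o t → Vertical o (τ t (pos n z)) (τ (clamp n (suc j)) (pos n z)))
      (isZero-pos z p′) (pred-clamp p) (vertical (clamp n (suc j)) (pos n z))

    -- Columns left of the heads sit at the far end of the cycle. The summand `length x` in `large`
    -- keeps them past the last letter, where the bottom row shows blanks.
    letter-pos : ∀ z → ∣ z ∣ ≤ suc T → at {Aux} (inputTape x) z ≡ symbol (letter x (toℕ (pos n z)))
    letter-pos (+ i) p = trans (at-input x i)
      (cong (symbol ∘ letter x) (sym (toℕ-clamp (ℕ.≤-trans p (ℕ.≤-trans (ℕ.n≤1+n _) 2+T≤n)))))
    letter-pos -[1+ i ] p = trans (at-input-left x i) (cong symbol (sym (letter-beyond x _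
      (subst (length x ≤_) (sym (toℕ-pos-left n i (s≤s i≤n)))
        (ℕ.m+n≤o⇒m≤o∸n (length x) (ℕ.≤-trans (ℕ.+-monoʳ-≤ (length x) i≤2+T) large))))))
      where
      i≤2+T : i ≤ 2 + T
      i≤2+T = ℕ.≤-trans (ℕ.n≤1+n i) (ℕ.m≤n⇒m≤1+n p)
      i≤n : i ≤ n
      i≤n = ℕ.≤-trans i≤2+T 2+T≤n

    enters-initial : EntersRow 1 (suc T) (initial x)
    enters-initial z p = subst (λ s → Enter (atOrigin z) start s (τ (clamp n 1) (pos n z)))
      (content-initial x _ z (letter-pos z p))
      (subst (λ t → Vertical (atOrigin z) t (τ (clamp n 1) (pos n z))) (bottom (pos n z))
        (vertical-pos 0 z (ℕ.≤-trans (s≤s z≤n) 2+T≤n) (ℕ.≤-trans p (ℕ.≤-trans (ℕ.n≤1+n _) 2+T≤n))))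

    -- Row `suc j` shows the configuration after j steps, correctly within radius w, and `j + w`
    -- stays `suc T`. At radius 0 the run would have `suc T` steps, against `bound`; so the tiling
    -- chose `nothing` at some earlier row, and `Legal` makes that configuration accepting.
    accepts-from : ∀ w j c → j + w ≡ suc T → Run j (initial x) c → EntersRow (suc j) w c → Accepts x
    accepts-from zero j c e r _ =
      ⊥-elim (ℕ.1+n≰n (subst (_≤ T) (trans (sym (ℕ.+-identityʳ j)) e) (bound j c r)))
    accepts-from (suc w) j c e r enters
      with shows-origin (τ (clamp n (suc j))) (horizontal _) (state c) (contents c) (suc w) w≤n enters
      where
      w≤n : suc w ≤ n
      w≤n = ℕ.≤-trans (ℕ.m+n≤o⇒n≤o j (ℕ.≤-reflexive e)) (ℕ.≤-trans (ℕ.n≤1+n _) 2+T≤n)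
    ... | nothing , (halted , acc) , _ = j , c , r , halted , acc
    ... | just (q′ , ws) , a∈ , origin =
      accepts-from w (suc j) (perform (q′ , ws) c) (trans (sym (ℕ.+-suc j w)) e)
        (r ▹▹ (_ , a∈ , refl)) enters′
      where
      w≤n : suc w ≤ n
      w≤n = ℕ.≤-trans (ℕ.m+n≤o⇒n≤o j (ℕ.≤-reflexive e)) (ℕ.≤-trans (ℕ.n≤1+n _) 2+T≤n)
      j<n : suc (suc j) ≤ n
      j<n = ℕ.≤-trans (s≤s (s≤s (ℕ.m+n≤o⇒m≤o j (ℕ.≤-reflexive (ℕ.suc-injective (trans (sym (ℕ.+-suc j w)) e)))))) 2+T≤n
      enters′ : EntersRow (suc (suc j)) w (perform (q′ , ws) c)
      enters′ z p = subst (λ s → Enter (atOrigin z) q′ s (τ (clamp n (suc (suc j))) (pos n z)))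
        (sym (content-writeMove ws (contents c) z))
        (subst (λ t → Vertical (atOrigin z) t (τ (clamp n (suc (suc j))) (pos n z)))
          (full-column (τ (clamp n (suc j))) (horizontal _) (state c) (contents c) w (just (q′ , ws)) w≤n
            (shows (τ (clamp n (suc j))) (horizontal _) (state c) (contents c) (suc w) w≤n enters
                   (just (q′ , ws)) origin) z p)
          (vertical-pos (suc j) z j<n (ℕ.≤-trans p (ℕ.≤-trans (ℕ.n≤1+n w) w≤n))))

    sound : Accepts x
    sound = accepts-from (suc T) 0 (initial x) refl done enters-initial

-- From accepting runs to tilings

-- The signed distance from 0 in the cycle 0, …, n, cut behind h.
offset : ℕ → ℕ → ℕ → ℤ
offset n h i with i ℕ.≤? h
... | yes _ = + i
... | no  _ = -[1+ n ∸ i ]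

offset-≤ : ∀ {n h i} → i ≤ h → offset n h i ≡ + i
offset-≤ {n} {h} {i} p with i ℕ.≤? h
... | yes _ = refl
... | no ¬p = ⊥-elim (¬p p)

offset-> : ∀ {n h i} → h < i → offset n h i ≡ -[1+ n ∸ i ]
offset-> {n} {h} {i} p with i ℕ.≤? h
... | yes q = ⊥-elim (ℕ.<⇒≱ p q)
... | no _  = refl

offset-step : ∀ n h i → suc i ≤ n →
  (offset n h i ≡ prev (offset n h (suc i))) ⊎ (i ≡ h)
offset-step n h i p with ℕ.<-cmp i h
... | tri< i<h _ _ = inj₁ (trans (offset-≤ (ℕ.<⇒≤ i<h)) (cong prev (sym (offset-≤ {n} i<h))))
... | tri≈ _ i≡h _ = inj₂ i≡h
... | tri> _ _ h<i = inj₁ (trans (offset-> h<i)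
  (trans (cong -[1+_] (suc-∸ p)) (cong prev (sym (offset-> {n} (ℕ.m≤n⇒m≤1+n h<i))))))

-- Cyclic neighbours are neighbours on the tape except at the cut, where column h meets the leftmost
-- column; there both distances from the heads are large.
offset-pred : ∀ {n} h (p : Fin (suc n)) → h < n →
  (offset n h (toℕ (cyclicPred p)) ≡ prev (offset n h (toℕ p)))
    ⊎ (h ≤ ∣ offset n h (toℕ (cyclicPred p)) ∣ × n ∸ h ≤ ∣ offset n h (toℕ p) ∣)
offset-pred {n} h zero h<n = inj₁ (trans (cong (offset n h) (Fin.toℕ-fromℕ n))
  (trans (offset-> h<n) (cong -[1+_] (ℕ.n∸n≡0 n))))
offset-pred {n} h (suc i) h<n rewrite Fin.toℕ-inject₁ i with offset-step n h (toℕ i) (Fin.toℕ<n i)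
... | inj₁ e    = inj₁ e
... | inj₂ refl = inj₂
  ( ℕ.≤-reflexive (cong ∣_∣ (sym (offset-≤ {n} (ℕ.≤-refl {toℕ i}))))
  , ℕ.≤-reflexive (trans (suc-∸ (Fin.toℕ<n i)) (cong ∣_∣ (sym (offset-> {n} (ℕ.n<1+n (toℕ i)))))) )

module Completeness (M : TM) where
  open TM M
  open Tiles M

  tileAt : Config → Maybe Action → ℤ → Tile
  tileAt c a z = run (state c , scans c , a)
    (afterWriting (contents c) a (prev z)) (afterWriting (contents c) a z) (afterWriting (contents c) a (next z))

  trace : ∀ {k c c′} → Run k c c′ → ℕ → ℤ → Tile
  trace (done {c})           zero    z = tileAt c nothing z
  trace done                 (suc j) z = final
  trace (_▸_ {c = c} (a , _) r) zero z = tileAt c (just a) z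
  trace (s ▸ r)              (suc j) z = trace r j z

  trace-end : ∀ {k c c′} (r : Run k c c′) j z → k < j → trace r j z ≡ final
  trace-end done    (suc j) z _       = refl
  trace-end (s ▸ r) (suc j) z (s≤s p) = trace-end r j z p

  trace-horizontal : ∀ {k c c′} (r : Run k c c′) j z → Horizontal (trace r j (prev z)) (trace r j z)
  trace-horizontal (done {c}) zero z =
    refl , refl , cong (afterWriting (contents c) nothing) (next-prev z)
  trace-horizontal done (suc j) z = tt
  trace-horizontal (_▸_ {c = c} (a , _) r) zero z =
    refl , refl , cong (afterWriting (contents c) (just a)) (next-prev z)
  trace-horizontal (s ▸ r) (suc j) z = trace-horizontal r j z

  BlankFrom : ℕ → Config → Set
  BlankFrom d c = ∀ z → d < ∣ z ∣ → content (contents c) z ≡ blanks tapes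

  off-origin : ∀ {d} z → d < ∣ z ∣ → atOrigin z ≡ false
  off-origin (+ suc i) _ = refl
  off-origin -[1+ i ]  _ = refl

  afterWriting-blank : ∀ {d c} a → BlankFrom d c → ∀ z → d < ∣ z ∣ →
                       afterWriting (contents c) a z ≡ blanks tapes
  afterWriting-blank {c = c} a b z p =
    trans (afterWriting-off (contents c) a z (off-origin z p)) (b z p)

  shifts-blank : ∀ {k} (ws : Vec (Symbol Aux × Move) k) {l m r} →
                 l ≡ blanks k → m ≡ blanks k → r ≡ blanks k → shifts ws l m r ≡ blanks k
  shifts-blank ws refl refl refl = shifts-blanks ws

  -- Relative to its head, a tape moves by at most one cell, and a symbol written at the origin
  -- stays within distance one.
  perform-blank : ∀ {d c} a → BlankFrom d c → BlankFrom (suc d) (perform a c)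
  perform-blank {d} {c} (q , ws) b z p = trans (content-writeMove ws (contents c) z)
    (shifts-blank ws (blank-at (prev z) (ℕ.≤-trans p (≤∣prev∣ z))) (blank-at z (ℕ.m≤n⇒m≤1+n p))
                     (blank-at (next z) (ℕ.≤-trans p (≤∣next∣ z))))
    where
    blank-at : ∀ z → suc d < suc ∣ z ∣ → content (overwrite ws (contents c)) z ≡ blanks tapes
    blank-at z (s≤s p) = afterWriting-blank {c = c} (just (q , ws)) b z p

  tile-blank : ∀ {d c} a → BlankFrom d c → ∀ z z′ → suc d < ∣ z ∣ → suc d < ∣ z′ ∣ →
               Horizontal (tileAt c a z) (tileAt c a z′)
  tile-blank {d} {c} a b z z′ p p′ =
      refl
    , trans (far z (ℕ.<⇒≤ p)) (sym (far (prev z′) (ℕ.≤-pred (ℕ.≤-trans p′ (≤∣prev∣ z′)))))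
    , trans (far (next z) (ℕ.≤-pred (ℕ.≤-trans p (≤∣next∣ z)))) (sym (far z′ (ℕ.<⇒≤ p′)))
    where
    far : ∀ z → d < ∣ z ∣ → afterWriting (contents c) a z ≡ blanks tapes
    far = afterWriting-blank {c = c} a b

  -- Needed at the cut, where matching columns are not adjacent on the tape: beyond the reach of k
  -- steps all columns are blank, so their tiles match in any order. The additional 1 accounts for
  -- the neighbouring columns stored in a tile.
  trace-blank : ∀ {k c c′} d (r : Run k c c′) → BlankFrom d c → ∀ j z z′ →
                suc (d + k) < ∣ z ∣ → suc (d + k) < ∣ z′ ∣ → Horizontal (trace r j z) (trace r j z′)
  trace-blank d done b zero z z′ p p′ = tile-blank nothing b z z′ (near p) (near p′)
    where
    near : ∀ {i} → suc (d + 0) < i → suc d < i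
    near = ℕ.≤-trans (s≤s (s≤s (ℕ.m≤m+n d 0)))
  trace-blank d done b (suc j) z z′ p p′ = tt
  trace-blank {suc k} d ((a , _) ▸ r) b zero z z′ p p′ = tile-blank (just a) b z z′ (near p) (near p′)
    where
    near : ∀ {i} → suc (d + suc k) < i → suc d < i
    near = ℕ.≤-trans (s≤s (s≤s (ℕ.m≤m+n d (suc k))))
  trace-blank {suc k} {c} d ((a , _ , refl) ▸ r) b (suc j) z z′ p p′ =
    trace-blank (suc d) r (perform-blank {c = c} a b) j z z′ (again p) (again p′)
    where
    again : ∀ {i} → suc (d + suc k) < i → suc (suc d + k) < i
    again {i} = subst (λ e → suc e < i) (ℕ.+-suc d k)

  initial-blank : ∀ x → BlankFrom (length x) (initial x)
  initial-blank x (+ i) p = sym (content-initial x nothing (+ i)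
    (trans (at-input x i) (cong symbol (letter-beyond x i (ℕ.<⇒≤ p)))))
  initial-blank x -[1+ i ] p = sym (content-initial x nothing -[1+ i ] (at-input-left x i))

  column : ∀ q ts a o z → atOrigin z ≡ o →
           Column o (q , Vec.map scanned ts , a) (content ts z) (afterWriting ts a z)
  column q ts a true  (+ zero) _ = refl , afterWriting-origin q ts a
  column q ts a false z        e = afterWriting-off ts a z e

  module _ {c′} (halted : Halted c′) (acc : accepting (state c′) ≡ true) where

    trace-enters : ∀ {k c} (r : Run k c c′) z →
                   Enter (atOrigin z) (state c) (content (contents c) z) (trace r 0 z)
    trace-enters done z =
      refl , (halted , acc) , column (state c′) (contents c′) nothing (atOrigin z) z refl
    trace-enters (_▸_ {c = c} (a , a∈ , _) r) z =
      refl , a∈ , column (state c) (contents c) (just a) (atOrigin z) z refl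

    trace-vertical : ∀ {k c} (r : Run k c c′) j z →
                     Vertical (atOrigin z) (trace r j z) (trace r (suc j) z)
    trace-vertical done    zero    z = tt
    trace-vertical done    (suc j) z = tt
    trace-vertical (_▸_ {c = c} ((q , ws) , _ , refl) r) zero z =
      subst (λ s → Enter (atOrigin z) q s (trace r 0 z)) (content-writeMove ws (contents c) z)
        (trace-enters r z)
    trace-vertical (s ▸ r) (suc j) z = trace-vertical r j z

    module _ {k x} (r : Run k (initial x) c′) (n : ℕ)
             (large : (2 + (length x + k)) + (2 + (length x + k)) < n) where

      private
        -- The least distance to which `trace-blank` applies when started from the input; `large`
        -- leaves room for it on both sides of the cut.
        h = 2 + (length x + k)
        h<n : h < n
        h<n = ℕ.≤-trans (s≤s (ℕ.m≤m+n h h)) large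

      computation : (t p : Fin (suc n)) → Tile
      computation zero    p = init (letter x (toℕ p))
      computation (suc t) p = trace r (toℕ t) (offset n h (toℕ p))

      offset-origin : ∀ (p : Fin (suc n)) → atOrigin (offset n h (toℕ p)) ≡ isZero p
      offset-origin zero    = refl
      offset-origin (suc i) with suc (toℕ i) ℕ.≤? h
      ... | yes _ = refl
      ... | no  _ = refl

      offset-content : ∀ i → letterColumn (letter x i) ≡ content (contents (initial x)) (offset n h i)
      offset-content i with i ℕ.≤? h
      ... | yes _ = content-initial x _ (+ i) (at-input x i)
      ... | no ¬p = content-initial x _ -[1+ n ∸ i ] (trans (at-input-left x (n ∸ i))
        (cong symbol (sym (letter-beyond x i (ℕ.≤-trans (ℕ.≤-trans (ℕ.m≤m+n _ k) (ℕ.m≤n+m _ 2)) (ℕ.<⇒≤ (ℕ.≰⇒> ¬p)))))))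

      complete : Tiling x computation
      complete = record { bottom = λ _ → refl ; horizontal = horizontal ; vertical = vertical }
        where
        horizontal : ∀ t p → Horizontal (computation t (cyclicPred p)) (computation t p)
        horizontal zero    p = tt
        horizontal (suc t) p with offset-pred h p h<n
        ... | inj₁ e         = subst (λ z → Horizontal (trace r (toℕ t) z) (computation (suc t) p)) (sym e)
                                 (trace-horizontal r (toℕ t) _)
        ... | inj₂ (far , far′) = trace-blank (length x) r (initial-blank x) (toℕ t) _ _ far
                                 (ℕ.≤-trans (ℕ.m+n≤o⇒m≤o∸n h (ℕ.<⇒≤ large)) far′)

        vertical : ∀ t p → Vertical (isZero p) (computation (cyclicPred t) p) (computation t p)
        vertical t p = subst (λ o → Vertical o (computation (cyclicPred t) p) (computation t p))
                         (offset-origin p) (vertical′ t)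
          where
          z = offset n h (toℕ p)
          lastRow : ∀ {n} (i : Fin (suc n)) → toℕ i ≡ n → suc k < n → ∃[ j ] (i ≡ suc j × k < toℕ j)
          lastRow (suc j) e (s≤s p) = j , refl , subst (k <_) (sym (ℕ.suc-injective e)) p
          vertical′ : ∀ t → Vertical (atOrigin z) (computation (cyclicPred t) p) (computation t p)
          -- The torus closes: the run is over before the last row, which is therefore `final` and
          -- may precede the `init` row.
          vertical′ zero with lastRow (fromℕ n) (Fin.toℕ-fromℕ n)
                                (ℕ.≤-trans (s≤s (s≤s (ℕ.≤-trans (ℕ.m≤n+m k (length x)) (ℕ.n≤1+n _)))) h<n)
          ... | j , e , k<j rewrite e | trace-end r (toℕ j) z k<j = tt
          vertical′ (suc zero)    = subst (λ s → Enter (atOrigin z) start s (trace r 0 z))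
            (sym (offset-content (toℕ p))) (trace-enters r z)
          vertical′ (suc (suc t)) = subst
            (λ j → Vertical (atOrigin z) (trace r j z) (trace r (suc (toℕ t)) z))
            (sym (Fin.toℕ-inject₁ t)) (trace-vertical r (toℕ t) z)

-- The theory and its well-founded model

-- Function symbols: the agent, the cyclic predecessor, the bottom row of the
-- tiling.  Predicates: Apred, the horizontal matching, and the vertical
-- matching in the column of the heads and in the other columns.
objectiveArityᶠ : Fin 3 → ℕ
objectiveArityᶠ 0F = 0
objectiveArityᶠ 1F = 1
objectiveArityᶠ 2F = 1

objectiveArityᵖ : Fin 4 → ℕ
objectiveArityᵖ 0F      = 1
objectiveArityᵖ (suc _) = 2

objective : ObjectiveVocabulary 1
objective = record
  { voc = record { FunSym = Fin 3 ; PredSym = Fin 4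
                 ; funArity = objectiveArityᶠ ; predArity = objectiveArityᵖ }
  ; agentConst       = λ _ → 0F
  ; agentConst-arity = λ _ → refl
  ; Apred            = 0F
  ; Apred-arity      = refl
  }

finite-objective : FiniteVocabulary (voc objective)
finite-objective = record { finite-FunSym = 3 , ↔-id _ ; finite-PredSym = 4 , ↔-id _ }

-- The only subjective symbol is the tiling (row, column) ↦ tile.
subjective : Vocabulary
subjective = record { FunSym = Fin 1 ; PredSym = Fin 0 ; funArity = λ _ → 2 ; predArity = λ () }

finite-subjective : FiniteVocabulary subjective
finite-subjective = record { finite-FunSym = 1 , ↔-id _ ; finite-PredSym = 0 , ↔-id _ }

vocabulary : Vocabulary
vocabulary = voc objective ⊎ᵛ subjective

module _ {n : ℕ} where

  -- The agent constant doubles as the coordinate 0 of both axes: the instances interpret it by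
  -- `zero`.
  origin : Term vocabulary n
  origin = app (inj₁ 0F) []

  predᵗ bottomᵗ : Term vocabulary n → Term vocabulary n
  predᵗ s   = app (inj₁ 1F) (s ∷ [])
  bottomᵗ s = app (inj₁ 2F) (s ∷ [])

  tileᵗ : (t p : Term vocabulary n) → Term vocabulary n
  tileᵗ t p = app (inj₂ 0F) (t ∷ p ∷ [])

  horizontalᶠ originVerticalᶠ verticalᶠ : (s t : Term vocabulary n) → Formula vocabulary n
  horizontalᶠ s t     = pred (inj₁ 1F) (s ∷ t ∷ [])
  originVerticalᶠ s t = pred (inj₁ 2F) (s ∷ t ∷ [])
  verticalᶠ s t       = pred (inj₁ 3F) (s ∷ t ∷ [])

  _⊃_ : (φ ψ : Formula vocabulary n) → Formula vocabulary n
  φ ⊃ ψ = ∼ (φ ∧ (∼ ψ))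

tilingSentence : Sentence vocabulary
tilingSentence = all (all
  ((tileᵗ origin p ≈ bottomᵗ p)
  ∧ (horizontalᶠ (tileᵗ t (predᵗ p)) (tileᵗ t p)
  ∧ (((p ≈ origin) ⊃ originVerticalᶠ (tileᵗ (predᵗ t) p) (tileᵗ t p))
  ∧ ((∼ (p ≈ origin)) ⊃ verticalᶠ (tileᵗ (predᵗ t) p) (tileᵗ t p))))))
  where
  t p : Term vocabulary 2
  t = var 1F
  p = var 0F

emptyTheory : FiniteTheory 1 vocabulary
emptyTheory _ = []

unsatisfiable satisfiable : Sentence vocabulary
unsatisfiable = ∼ tilingSentence
satisfiable   = ∼ K origin unsatisfiable

agentTerm : Term (voc objective) 0
agentTerm = app 0F []

-- Modal-free formulas are two-valued

ModalFree : ∀ {V n} → Formula V n → Set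
ModalFree (pred P ts) = ⊤
ModalFree (s ≈ t)     = ⊤
ModalFree (φ ∧ ψ)     = ModalFree φ × ModalFree ψ
ModalFree (∼ φ)       = ModalFree φ
ModalFree (all φ)     = ModalFree φ
ModalFree (K t φ)     = ⊥

all-or-some : ∀ {n} {P Q : Fin n → Set} → (∀ d → P d ⊎ Q d) → (∀ d → P d) ⊎ (∃[ d ] Q d)
all-or-some {zero}  pq = inj₁ λ ()
all-or-some {suc n} pq with pq zero | all-or-some (pq ∘ suc)
... | inj₂ q | _            = inj₂ (zero , q)
... | inj₁ _ | inj₂ (d , q) = inj₂ (suc d , q)
... | inj₁ p | inj₁ ps      = inj₁ λ { zero → p ; (suc d) → ps d }

module _ {m} {Σₒ : ObjectiveVocabulary m} {Σₛ : Vocabulary} where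

  module _ {D : Set} {Iₒ : ObjectiveStructure Σₒ D} where
    open Semantics Σₒ Σₛ Iₒ

    -- The clauses of truth and falsity can overlap only at K, for an inconsistent pair; without K
    -- the pair is never consulted.
    exclusive : ∀ {n} B I (a : Vec D n) φ → ModalFree φ → IsTrue B I a φ → ¬ IsFalse B I a φ
    exclusive B I a (pred P ts) _         t f with () ← trans (sym t) f
    exclusive B I a (s ≈ u)     _         t f        = f t
    exclusive B I a (φ ∧ ψ)     (mφ , mψ) t (inj₁ f) = exclusive B I a φ mφ (proj₁ t) f
    exclusive B I a (φ ∧ ψ)     (mφ , mψ) t (inj₂ f) = exclusive B I a ψ mψ (proj₂ t) f
    exclusive B I a (∼ φ)       mφ        t f        = exclusive B I a φ mφ f t
    exclusive B I a (all φ)     mφ        t (d , f)  = exclusive B I (d ∷ a) φ mφ (t d) f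

  module _ {k} {Iₒ : ObjectiveStructure Σₒ (Fin k)} where
    open Semantics Σₒ Σₛ Iₒ

    -- Falsity of a quantifier asks for a counterexample, which is constructively more than the
    -- failure of truth; over a finite domain it can be searched for. The co-NP side uses this to
    -- turn the absence of models into falsity at every world.
    decide : ∀ {n} B I (a : Vec (Fin k) n) φ → ModalFree φ → IsTrue B I a φ ⊎ IsFalse B I a φ
    decide B I a (pred P ts) _ with ⟦ full I ⟧ᵖ P (evalᵗˢ (full I) a ts)
    ... | true  = inj₁ refl
    ... | false = inj₂ refl
    decide B I a (s ≈ t) _ with evalᵗ (full I) a s Fin.≟ evalᵗ (full I) a t
    ... | yes e = inj₁ e
    ... | no ¬e = inj₂ ¬e
    decide B I a (φ ∧ ψ) (mφ , mψ) with decide B I a φ mφ | decide B I a ψ mψ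
    ... | inj₁ p | inj₁ q = inj₁ (p , q)
    ... | inj₂ p | _      = inj₂ (inj₁ p)
    ... | inj₁ _ | inj₂ q = inj₂ (inj₂ q)
    decide B I a (∼ φ) mφ with decide B I a φ mφ
    ... | inj₁ t = inj₂ t
    ... | inj₂ f = inj₁ f
    decide B I a (all φ) mφ = all-or-some (λ d → decide B I (d ∷ a) φ mφ)

module _ {D : Set} (Iₒ : ObjectiveStructure objective D) where
  open Semantics objective subjective Iₒ

  everything : BeliefPair
  everything = ⟨ (λ _ _ → ⊤) , (λ _ _ → ⊤) ⟩

  everything-stable : IsStable emptyTheory (λ _ _ → ⊤) (λ _ _ → ⊤)
  everything-stable = (λ A → (λ _ ()) , λ _ → tt) , λ _ _ _ _ → tt

  -- No structure falsifies an empty set of sentences. This gives leastness of `everything`, and it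
  -- also identifies the possible worlds of whatever well-founded model a `Yes` certificate
  -- contains.
  fixpoint-full : ∀ {Q Q′} → IsFixpoint emptyTheory Q Q′ → ∀ A I → Q′ A I
  fixpoint-full fix A I = proj₂ (fix A) λ ()

  everything-WF : IsWFModel emptyTheory everything
  everything-WF = ((λ _ _ → tt) , everything-stable , everything-stable) ,
    λ B (_ , _ , fix , _) → (λ _ _ → tt) , λ A _ → fixpoint-full fix A _

module _ (S : FiniteStructure objective) where
  open Semantics objective subjective (structure S)

  Satisfiable : Set
  Satisfiable = ∃[ J ] IsTrue (everything (structure S)) J [] tilingSentence

  yes-satisfiable : DecisionProblem.Yes
    (Task1 objective finite-objective subjective emptyTheory agentTerm satisfiable) S ⇔ Satisfiable
  yes-satisfiable = mk⇔ to from
    where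
    -- Any structure will do: it instantiates the quantifier over `I` in `Yes`, and then serves as a
    -- world that the agent holds possible.
    someStructure : Structure
    someStructure = record { ⟦_⟧ᶠ = λ { 0F (d ∷ _) → d } ; ⟦_⟧ᵖ = λ () }
    to : _ → Satisfiable
    to (B , (((_ , (fix , _) , _)) , _) , holds) with holds someStructure
    ... | A , _ , believes with believes someStructure (fixpoint-full (structure S) fix A someStructure)
    ...   | inj₁ noAgent                = ⊥-elim (noAgent (0F , refl))
    ...   | inj₂ (_ , _ , J , _ , h) = J , h
    from : Satisfiable → _
    from (J , h) = everything (structure S) , everything-WF (structure S) ,
      λ I → 0F , refl , λ _ _ → inj₂ (0F , refl , J , tt , h)

  yes-unsatisfiable : DecisionProblem.Yes
    (Task1 objective finite-objective subjective emptyTheory agentTerm unsatisfiable) S ⇔ (¬ Satisfiable)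
  yes-unsatisfiable = mk⇔ to from
    where
    to : _ → ¬ Satisfiable
    to (B , (((_ , (fix , _) , _)) , _) , holds) (J , h) with holds J
    -- `h` is stated for `everything`, but the valuation of the K-free sentence computes to the same
    -- type for `B`.
    ... | A , _ , believes = exclusive {Iₒ = structure S} B J [] tilingSentence _ h
      (believes J (fixpoint-full (structure S) fix A J))
    from : ¬ Satisfiable → _
    from unsat = everything (structure S) , everything-WF (structure S) , λ I → 0F , refl , λ J _ → false-at J
      where
      false-at : ∀ J → IsFalse (everything (structure S)) J [] tilingSentence
      false-at J with decide {Iₒ = structure S} (everything (structure S)) J [] tilingSentence _
      ... | inj₁ h = ⊥-elim (unsat (J , h))
      ... | inj₂ h = h

-- Tiling instances as objective structures

module _ (n : ℕ) (bottom : Fin (suc n) → Fin (suc n)) (H V₁ V₀ : (s t : Fin (suc n)) → Bool) where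

  tilingInterpretation : Interpretation (voc objective) (Fin (suc n))
  tilingInterpretation = record
    { ⟦_⟧ᶠ = λ { 0F _ → zero ; 1F (i ∷ []) → cyclicPred i ; 2F (p ∷ []) → bottom p }
    ; ⟦_⟧ᵖ = λ { 0F (d ∷ []) → isZero d ; 1F (s ∷ t ∷ []) → H s t
               ; 2F (s ∷ t ∷ []) → V₁ s t ; 3F (s ∷ t ∷ []) → V₀ s t }
    }

  tilingStructure : FiniteStructure objective
  tilingStructure = record
    { size      = suc n
    ; nonEmpty  = _
    ; structure = record
      { interp          = tilingInterpretation
      ; agent-injective = λ { {0F} {0F} _ → refl }
      ; Apred-correct   = λ d → mk⇔ (isZero-sound d) λ { (_ , refl) → refl }
      }
    }
    where
    isZero-sound : ∀ d → isZero d ≡ true → Fin 1 × zero ≡ d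
    isZero-sound zero _ = 0F , refl

  -- Written as the truth clauses of `tilingSentence` compute, with each implication as a
  -- disjunction, so that `satisfiable-matches` can pass proofs on unchanged.
  Matches : (τ : (t p : Fin (suc n)) → Fin (suc n)) → Set
  Matches τ = ∀ t p →
      τ zero p ≡ bottom p
    × H (τ t (cyclicPred p)) (τ t p) ≡ true
    × (p ≢ zero ⊎ V₁ (τ (cyclicPred t) p) (τ t p) ≡ true)
    × (p ≡ zero ⊎ V₀ (τ (cyclicPred t) p) (τ t p) ≡ true)

  satisfiable-matches : Satisfiable tilingStructure ⇔ (∃[ τ ] Matches τ)
  satisfiable-matches = mk⇔
    (λ (J , holds) → (λ t p → ⟦ J ⟧ᶠ 0F (t ∷ p ∷ [])) , holds)
    (λ (τ , holds) → record { ⟦_⟧ᶠ = λ { 0F (t ∷ p ∷ []) → τ t p } ; ⟦_⟧ᵖ = λ () } , holds)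

-- The encoding of a tiling instance

zeros : ℕ → Word
zeros n = replicate n false

repeat-+ : ∀ m n w → repeat (m + n) w ≡ repeat m w ++ repeat n w
repeat-+ zero    n w = refl
repeat-+ (suc m) n w = trans (cong (w ++_) (repeat-+ m n w)) (sym (List.++-assoc w _ _))

tabulate-+ : ∀ {A : Set} m {n} (f : Fin (m + n) → A) →
             tabulate f ≡ tabulate (f ∘ (_↑ˡ n)) ++ tabulate (f ∘ (m ↑ʳ_))
tabulate-+ zero    f = refl
tabulate-+ (suc m) f = cong (f zero ∷_) (tabulate-+ m (f ∘ suc))

tabulate-const : ∀ {A : Set} n {f : Fin n → A} a → (∀ i → f i ≡ a) → tabulate f ≡ replicate n a
tabulate-const zero    a e = refl
tabulate-const (suc n) a e = cong₂ _∷_ (e zero) (tabulate-const n a (e ∘ suc))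

concatMap-allFin : ∀ {A : Set} n (f : Fin n → List A) → concatMap f (allFin n) ≡ concat (tabulate f)
concatMap-allFin n f = cong concat (List.map-tabulate id f)

tuples₁ : ∀ n → tuples n 1 ≡ tabulate (_∷ [])
tuples₁ n = trans (concatMap-allFin n (λ d → (d ∷ []) ∷ [])) (singletons (_∷ []))
  where
  singletons : ∀ {A : Set} {n} (f : Fin n → A) → concat (tabulate (λ d → f d ∷ [])) ≡ tabulate f
  singletons {n = zero}  f = refl
  singletons {n = suc n} f = cong (f zero ∷_) (singletons (f ∘ suc))

map-tuples₁ : ∀ {A : Set} n (f : Vec (Fin n) 1 → A) → map f (tuples n 1) ≡ tabulate (λ d → f (d ∷ []))
map-tuples₁ n f = trans (cong (map f) (tuples₁ n)) (List.map-tabulate _ f)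

map-tuples₂ : ∀ {A : Set} n (f : Vec (Fin n) 2 → A) →
              map f (tuples n 2) ≡ concat (tabulate (λ d → tabulate (λ e → f (d ∷ e ∷ []))))
map-tuples₂ n f = begin
  map f (concatMap (λ d → map (d ∷_) (tuples n 1)) (allFin n))
    ≡⟨ List.map-concatMap f _ (allFin n) ⟩
  concatMap (λ d → map f (map (d ∷_) (tuples n 1))) (allFin n)
    ≡⟨ concatMap-allFin n _ ⟩
  concat (tabulate (λ d → map f (map (d ∷_) (tuples n 1))))
    ≡⟨ cong concat (List.tabulate-cong {n = n} (λ d → trans (sym (List.map-∘ {g = f} {f = d ∷_} (tuples n 1))) (map-tuples₁ n _))) ⟩
  concat (tabulate (λ d → tabulate (λ e → f (d ∷ e ∷ []))))
    ∎
  where open ≡-Reasoning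

oneHot-↑ˡ : ∀ {k} (i : Fin k) m → oneHot (i ↑ˡ m) ≡ oneHot i ++ zeros m
oneHot-↑ˡ {suc k} zero    m = cong (true ∷_) (replicate-+ k m false)
oneHot-↑ˡ         (suc i) m = cong (false ∷_) (oneHot-↑ˡ i m)

oneHot-fromℕ : ∀ n → oneHot (fromℕ n) ≡ zeros n ++ true ∷ []
oneHot-fromℕ zero    = refl
oneHot-fromℕ (suc n) = cong (false ∷_) (oneHot-fromℕ n)

zeros-snoc : ∀ n → zeros (suc n) ≡ zeros n ++ false ∷ []
zeros-snoc n = trans (cong zeros (sym (ℕ.+-comm n 1))) (replicate-+ n 1 false)

oneHot-inject₁ : ∀ {n} (i : Fin n) → oneHot (inject₁ i) ≡ oneHot i ++ zeros 1
oneHot-inject₁ {suc n} zero    = cong (true ∷_) (zeros-snoc n)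
oneHot-inject₁         (suc i) = cong (false ∷_) (oneHot-inject₁ i)

-- The same bits with the row borders moved by one place: the 0 that opens a row becomes the 0 that
-- closes the row before it.
rotate : ∀ {n} (f : Fin n → Word) w →
         concat (tabulate (λ i → false ∷ f i)) ++ false ∷ w ≡ false ∷ concat (tabulate (λ i → f i ++ false ∷ [])) ++ w
rotate {zero}  f w = refl
rotate {suc n} f w = cong (false ∷_) (begin
  (f zero ++ concat (tabulate (λ i → false ∷ f (suc i)))) ++ false ∷ w
    ≡⟨ List.++-assoc (f zero) _ _ ⟩
  f zero ++ (concat (tabulate (λ i → false ∷ f (suc i))) ++ false ∷ w)
    ≡⟨ cong (f zero ++_) (rotate (f ∘ suc) w) ⟩
  f zero ++ false ∷ (concat (tabulate (λ i → f (suc i) ++ false ∷ [])) ++ w)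
    ≡⟨ sym (List.++-assoc (f zero) (false ∷ []) _) ⟩
  (f zero ++ false ∷ []) ++ (concat (tabulate (λ i → f (suc i) ++ false ∷ [])) ++ w)
    ≡⟨ sym (List.++-assoc (f zero ++ false ∷ []) _ _) ⟩
  ((f zero ++ false ∷ []) ++ concat (tabulate (λ i → f (suc i) ++ false ∷ []))) ++ w
    ∎)
  where open ≡-Reasoning

-- In an n × (n + e) bit table with ones on the diagonal, consecutive ones are
-- n + e + 1 places apart; n additional zeros complete the last period.
diagonal : ∀ n e → concat (tabulate {n = n} (λ i → oneHot i ++ zeros e)) ++ zeros n
                   ≡ repeat n (true ∷ zeros (n + e))
diagonal zero    e = refl
diagonal (suc n) e = cong (true ∷_) (begin
  ((zeros n ++ zeros e) ++ concat (tabulate (λ i → false ∷ row i))) ++ false ∷ zeros n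
    ≡⟨ List.++-assoc (zeros n ++ zeros e) _ _ ⟩
  (zeros n ++ zeros e) ++ (concat (tabulate (λ i → false ∷ row i)) ++ false ∷ zeros n)
    ≡⟨ cong₂ _++_ (sym (replicate-+ n e false)) (rotate row (zeros n)) ⟩
  zeros (n + e) ++ false ∷ (concat (tabulate (λ i → row i ++ false ∷ [])) ++ zeros n)
    ≡⟨ cong (λ r → zeros (n + e) ++ false ∷ (concat r ++ zeros n)) (List.tabulate-cong {n = n} longer) ⟩
  zeros (n + e) ++ false ∷ (concat (tabulate {n = n} (λ i → oneHot i ++ zeros (suc e))) ++ zeros n)
    ≡⟨ cong (λ r → zeros (n + e) ++ false ∷ r) (diagonal n (suc e)) ⟩
  zeros (n + e) ++ false ∷ repeat n (true ∷ zeros (n + suc e))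
    ≡⟨ sym (List.++-assoc (zeros (n + e)) (false ∷ []) _) ⟩
  (zeros (n + e) ++ false ∷ []) ++ repeat n (true ∷ zeros (n + suc e))
    ≡⟨ cong₂ (λ u v → u ++ repeat n (true ∷ zeros v)) (sym (zeros-snoc (n + e))) (ℕ.+-suc n e) ⟩
  zeros (suc (n + e)) ++ repeat n (true ∷ zeros (suc (n + e)))
    ∎)
  where
  open ≡-Reasoning
  row : Fin n → Word
  row i = oneHot i ++ zeros e
  longer : ∀ i → row i ++ false ∷ [] ≡ oneHot i ++ zeros (suc e)
  longer i = trans (List.++-assoc (oneHot i) (zeros e) _) (cong (oneHot i ++_) (sym (zeros-snoc e)))

repeat-snoc : ∀ n w → repeat (suc n) w ≡ repeat n w ++ w
repeat-snoc n w = trans (cong (λ k → repeat k w) (sym (ℕ.+-comm n 1)))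
  (trans (repeat-+ n 1 w) (cong (repeat n w ++_) (List.++-identityʳ w)))

-- Row 0 has its one in the last column. The remaining rows are a diagonal with one spare column, so
-- their ones recur at distance size + 1, and the table ends after the first two bits of the last
-- period.
cyclicPred-table : ∀ n → concat (tabulate {n = suc (suc n)} (oneHot ∘ cyclicPred))
  ≡ zeros (suc n) ++ true ∷ repeat n (true ∷ zeros (suc (suc n))) ++ true ∷ false ∷ []
cyclicPred-table n = begin
  oneHot (fromℕ (suc n)) ++ concat (tabulate {n = suc n} (oneHot ∘ inject₁))
    ≡⟨ cong₂ _++_ (oneHot-fromℕ (suc n)) (cong concat (List.tabulate-cong {n = suc n} oneHot-inject₁)) ⟩
  (zeros (suc n) ++ true ∷ []) ++ concat (tabulate {n = suc n} (λ i → oneHot i ++ zeros 1))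
    ≡⟨ cong ((zeros (suc n) ++ true ∷ []) ++_) body ⟩
  (zeros (suc n) ++ true ∷ []) ++ (repeat n (true ∷ zeros (suc (suc n))) ++ true ∷ false ∷ [])
    ≡⟨ List.++-assoc (zeros (suc n)) _ _ ⟩
  zeros (suc n) ++ true ∷ repeat n (true ∷ zeros (suc (suc n))) ++ true ∷ false ∷ []
    ∎
  where
  open ≡-Reasoning
  body : concat (tabulate {n = suc n} (λ i → oneHot i ++ zeros 1))
         ≡ repeat n (true ∷ zeros (suc (suc n))) ++ true ∷ false ∷ []
  -- `diagonal` speaks of complete periods; the zeros that complete the last one are appended to
  -- both sides and cancelled.
  body = List.++-cancelʳ (zeros (suc n)) _ _ (begin
    concat (tabulate {n = suc n} (λ i → oneHot i ++ zeros 1)) ++ zeros (suc n)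
      ≡⟨ diagonal (suc n) 1 ⟩
    repeat (suc n) (true ∷ zeros (suc n + 1))
      ≡⟨ cong (λ v → repeat (suc n) (true ∷ zeros v)) (ℕ.+-comm (suc n) 1) ⟩
    repeat (suc n) (true ∷ zeros (suc (suc n)))
      ≡⟨ repeat-snoc n _ ⟩
    repeat n (true ∷ zeros (suc (suc n))) ++ true ∷ false ∷ zeros (suc n)
      ≡⟨ sym (List.++-assoc (repeat n (true ∷ zeros (suc (suc n)))) (true ∷ false ∷ []) _) ⟩
    (repeat n (true ∷ zeros (suc (suc n))) ++ true ∷ false ∷ []) ++ zeros (suc n)
      ∎)

letter-table : ∀ (f : Maybe Bool → Word) x n → length x ≤ n →
  concat (tabulate {n = n} (λ p → f (letter x (toℕ p))))
    ≡ concatMap (f ∘ just) x ++ repeat (n ∸ length x) (f nothing)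
letter-table f []      n       _       = cong concat (tabulate-const n (f nothing) (λ _ → refl))
letter-table f (b ∷ x) (suc n) (s≤s p) =
  trans (cong (f (just b) ++_) (letter-table f x n p)) (sym (List.++-assoc (f (just b)) _ _))

text-++ : ∀ x m ks ls → text x m (ks ++ ls) ≡ text x m ks ++ text x m ls
text-++ x m ks ls = List.concatMap-++ (blockText x m) ks ls

text-tabulate : ∀ x m {n} (f : Fin n → Block) → text x m (tabulate f) ≡ concat (tabulate (blockText x m ∘ f))
text-tabulate x m f = cong concat (List.map-tabulate f (blockText x m))

text-replicate : ∀ x m n k → text x m (replicate n k) ≡ repeat n (blockText x m k)
text-replicate x m n k = cong concat (List.map-replicate (blockText x m) n k)

module Encoding {k : ℕ} {Tile : Set} (dec : Fin (2 + k) → Tile) (final : Tile)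
                (letterCode : Maybe Bool → Fin (2 + k)) (H V₁ V₀ : Tile → Tile → Bool) where

  private
    tiles = 2 + k

  letterWord : Maybe Bool → Word
  letterWord b = oneHot (letterCode b)

  relationRow : (Word → Bool → Block) → (Tile → Tile → Bool) → Tile → Block
  relationRow block F s = block (tabulate (F s ∘ dec)) (F s final)

  -- The m elements beyond the codes all mean `final`. Hence every row ends in m equal bits and the
  -- last m rows coincide, so the number of blocks does not depend on the input.
  relationBlocks : (Tile → Tile → Bool) → List Block
  relationBlocks F = tabulate (relationRow line F ∘ dec) ++ relationRow lines F final ∷ []

  sizeBlocks agentBlocks predBlocks bottomBlocks ApredBlocks : List Block
  sizeBlocks   = line (replicate tiles true) true ∷ []
  agentBlocks  = line (true ∷ zeros (suc k)) false ∷ []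
  predBlocks   = line (zeros (suc k)) false ∷ once (true ∷ [])
               ∷ replicate k (line (true ∷ zeros tiles) false)
               ++ lines (true ∷ zeros tiles) false ∷ once (true ∷ false ∷ []) ∷ []
  -- The `input` block accounts for m of the `tiles + m` positions; the remaining `tiles` positions
  -- carry no letter.
  bottomBlocks = input (letterWord (just true)) (letterWord (just false)) (letterWord nothing)
               ∷ replicate tiles (line (letterWord nothing) false)
  ApredBlocks  = line (true ∷ zeros (suc k)) false ∷ []

  functionBlocks predicateBlocks verticalBlocks blocks : List Block
  functionBlocks  = agentBlocks ++ (predBlocks ++ (bottomBlocks ++ []))
  verticalBlocks  = relationBlocks V₁ ++ (relationBlocks V₀ ++ [])
  predicateBlocks = ApredBlocks ++ (relationBlocks H ++ verticalBlocks)
  blocks          = sizeBlocks ++ once (false ∷ []) ∷ (functionBlocks ++ predicateBlocks)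

  module _ (x : Word) (m : ℕ) where

    decode : Fin (tiles + m) → Tile
    decode i = [ dec , (λ _ → final) ]′ (splitAt tiles i)

    relation : (Tile → Tile → Bool) → (i j : Fin (tiles + m)) → Bool
    relation F i j = F (decode i) (decode j)

    bottomTile : Fin (tiles + m) → Fin (tiles + m)
    bottomTile p = letterCode (letter x (toℕ p)) ↑ˡ m

    I : Interpretation (voc objective) (Fin (tiles + m))
    I = tilingInterpretation (suc (k + m)) bottomTile (relation H) (relation V₁) (relation V₀)

    instanceOf : FiniteStructure objective
    instanceOf = tilingStructure (suc (k + m)) bottomTile (relation H) (relation V₁) (relation V₀)

    Solves : (τ : (t p : Fin (tiles + m)) → Fin (tiles + m)) → Set
    Solves = Matches (suc (k + m)) bottomTile (relation H) (relation V₁) (relation V₀)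

    satisfiable-solves : Satisfiable instanceOf ⇔ (∃[ τ ] Solves τ)
    satisfiable-solves = satisfiable-matches (suc (k + m)) bottomTile (relation H) (relation V₁) (relation V₀)

    relation-text : ∀ F → concat (tabulate (λ i → tabulate (λ j → F (decode i) (decode j))))
                          ≡ text x m (relationBlocks F)
    relation-text F = begin
      concat (tabulate (λ i → tabulate (λ j → F (decode i) (decode j))))
        ≡⟨ cong concat (List.tabulate-cong (λ i → row (decode i))) ⟩
      concat (tabulate (rowText ∘ decode))
        ≡⟨ cong concat (tabulate-+ tiles (rowText ∘ decode)) ⟩
      concat (tabulate (λ i → rowText (decode (i ↑ˡ m))) ++ tabulate (λ i → rowText (decode (tiles ↑ʳ i))))
        ≡⟨ sym (List.concat-++ (tabulate (λ i → rowText (decode (i ↑ˡ m)))) _) ⟩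
      concat (tabulate (λ i → rowText (decode (i ↑ˡ m)))) ++ concat (tabulate (λ i → rowText (decode (tiles ↑ʳ i))))
        ≡⟨ cong₂ (λ u v → concat u ++ concat v)
             (List.tabulate-cong (λ i → cong rowText (decode-left i)))
             (tabulate-const m (rowText final) (λ i → cong rowText (decode-right i))) ⟩
      concat (tabulate (rowText ∘ dec)) ++ repeat m (rowText final)
        ≡⟨ cong₂ _++_ (sym (text-tabulate x m (relationRow line F ∘ dec))) (sym (List.++-identityʳ (repeat m (rowText final)))) ⟩
      text x m (tabulate (relationRow line F ∘ dec)) ++ text x m (relationRow lines F final ∷ [])
        ≡⟨ sym (text-++ x m (tabulate (relationRow line F ∘ dec)) _) ⟩
      text x m (relationBlocks F)
        ∎
      where
      open ≡-Reasoning
      rowText : Tile → Word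
      rowText s = lineText m (tabulate (F s ∘ dec)) (F s final)
      decode-left : ∀ i → decode (i ↑ˡ m) ≡ dec i
      decode-left i = cong [ dec , (λ _ → final) ]′ (Fin.splitAt-↑ˡ tiles i m)
      decode-right : ∀ i → decode (tiles ↑ʳ i) ≡ final
      decode-right i = cong [ dec , (λ _ → final) ]′ (Fin.splitAt-↑ʳ tiles m i)
      row : ∀ s → tabulate (λ j → F s (decode j)) ≡ rowText s
      row s = trans (tabulate-+ tiles (F s ∘ decode)) (cong₂ _++_
        (List.tabulate-cong (λ j → cong (F s) (decode-left j)))
        (tabulate-const m (F s final) (λ j → cong (F s) (decode-right j))))

    size-text : replicate (tiles + m) true ≡ text x m sizeBlocks
    size-text = trans (replicate-+ tiles m true) (sym (List.++-identityʳ _))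

    agent-text : (true ∷ zeros (suc (k + m))) ++ [] ≡ text x m agentBlocks
    agent-text = cong (_++ []) (cong (true ∷_) (replicate-+ (suc k) m false))

    pred-text : concat (tabulate {n = tiles + m} (oneHot ∘ cyclicPred)) ≡ text x m predBlocks
    pred-text = begin
      concat (tabulate {n = tiles + m} (oneHot ∘ cyclicPred))
        ≡⟨ cyclicPred-table (k + m) ⟩
      zeros (suc k + m) ++ true ∷ repeat (k + m) w ++ true ∷ false ∷ []
        ≡⟨ cong₂ (λ u v → u ++ true ∷ v ++ true ∷ false ∷ []) (replicate-+ (suc k) m false)
             (trans (cong (repeat (k + m)) w-text) (repeat-+ k m _)) ⟩
      lineText m (zeros (suc k)) false ++ true ∷ (repeat k w′ ++ repeat m w′) ++ true ∷ false ∷ []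
        ≡⟨ cong (λ u → lineText m (zeros (suc k)) false ++ true ∷ u) (List.++-assoc (repeat k w′) _ _) ⟩
      lineText m (zeros (suc k)) false ++ true ∷ repeat k w′ ++ text x m rest
        ≡⟨ cong (λ u → lineText m (zeros (suc k)) false ++ true ∷ u ++ text x m rest)
             (sym (text-replicate x m k (line (true ∷ zeros tiles) false))) ⟩
      lineText m (zeros (suc k)) false ++ true ∷ text x m (replicate k (line (true ∷ zeros tiles) false)) ++ text x m rest
        ≡⟨ cong (λ u → lineText m (zeros (suc k)) false ++ true ∷ u)
             (sym (text-++ x m (replicate k (line (true ∷ zeros tiles) false)) rest)) ⟩
      text x m predBlocks
        ∎
      where
      open ≡-Reasoning
      w w′ : Word
      w  = true ∷ zeros (tiles + m)
      w′ = lineText m (true ∷ zeros tiles) false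
      rest : List Block
      rest = lines (true ∷ zeros tiles) false ∷ once (true ∷ false ∷ []) ∷ []
      w-text : w ≡ w′
      w-text = cong (true ∷_) (replicate-+ tiles m false)

    module _ (n≤m : length x ≤ m) where

      bottom-text : concat (tabulate (oneHot ∘ bottomTile)) ≡ text x m bottomBlocks
      bottom-text = begin
        concat (tabulate (oneHot ∘ bottomTile))
          ≡⟨ cong concat (List.tabulate-cong {n = tiles + m} (λ p → oneHot-↑ˡ (letterCode (letter x (toℕ p))) m)) ⟩
        concat (tabulate {n = tiles + m} (λ p → row (letter x (toℕ p))))
          ≡⟨ letter-table row x (tiles + m) (ℕ.≤-trans n≤m (ℕ.m≤n+m m tiles)) ⟩
        concatMap (row ∘ just) x ++ repeat (tiles + m ∸ length x) (row nothing)
          ≡⟨ cong₂ (λ u v → u ++ repeat v (row nothing)) (List.concatMap-cong bits x) lengths ⟩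
        concatMap bitRow x ++ repeat (m ∸ length x + tiles) (row nothing)
          ≡⟨ cong (concatMap bitRow x ++_) (repeat-+ (m ∸ length x) tiles (row nothing)) ⟩
        concatMap bitRow x ++ (repeat (m ∸ length x) (row nothing) ++ repeat tiles (row nothing))
          ≡⟨ sym (List.++-assoc (concatMap bitRow x) _ _) ⟩
        (concatMap bitRow x ++ repeat (m ∸ length x) (row nothing)) ++ repeat tiles (row nothing)
          ≡⟨ cong ((concatMap bitRow x ++ repeat (m ∸ length x) (row nothing)) ++_)
               (sym (text-replicate x m tiles (line (letterWord nothing) false))) ⟩
        text x m bottomBlocks
          ∎
        where
        open ≡-Reasoning
        row : Maybe Bool → Word
        row b = lineText m (letterWord b) false
        bitRow : Bool → Word
        bitRow b = lineText m (if b then letterWord (just true) else letterWord (just false)) false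
        bits : ∀ b → row (just b) ≡ bitRow b
        bits true  = refl
        bits false = refl
        lengths : tiles + m ∸ length x ≡ m ∸ length x + tiles
        lengths = trans (ℕ.+-∸-assoc tiles n≤m) (ℕ.+-comm tiles _)

      Apred-text : map (⟦ I ⟧ᵖ 0F) (tuples (tiles + m) 1) ≡ text x m ApredBlocks
      Apred-text = trans (map-tuples₁ (tiles + m) _) (cong (true ∷_)
        (trans (tabulate-const (suc (k + m)) false (λ _ → refl))
        (trans (replicate-+ (suc k) m false) (sym (List.++-identityʳ _)))))

      unary-text : (f : Vec (Fin (tiles + m)) 1 → Fin (tiles + m)) →
        concatMap (λ v → oneHot (f v)) (tuples (tiles + m) 1) ≡ concat (tabulate (λ d → oneHot (f (d ∷ []))))
      unary-text f = cong concat (map-tuples₁ (tiles + m) (λ v → oneHot (f v)))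

      encode-text : encodeStructure finite-objective instanceOf ≡ text x m blocks
      encode-text = section sizeBlocks (once (false ∷ []) ∷ (functionBlocks ++ predicateBlocks)) size-text
        (cong (false ∷_) (section functionBlocks predicateBlocks functions-text predicates-text))
        where
        section : ∀ ks ls {u v} → u ≡ text x m ks → v ≡ text x m ls → u ++ v ≡ text x m (ks ++ ls)
        section ks ls e f = trans (cong₂ _++_ e f) (sym (text-++ x m ks ls))
        binary-text : ∀ F (f : Vec (Fin (tiles + m)) 2 → Bool) →
          (∀ i j → f (i ∷ j ∷ []) ≡ relation F i j) →
          map f (tuples (tiles + m) 2) ≡ text x m (relationBlocks F)
        binary-text F f e = trans (map-tuples₂ (tiles + m) f)
          (trans (cong concat (List.tabulate-cong (λ i → List.tabulate-cong (e i)))) (relation-text F))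
        functions-text : _ ≡ text x m functionBlocks
        functions-text = section agentBlocks (predBlocks ++ (bottomBlocks ++ [])) agent-text
          (section predBlocks (bottomBlocks ++ [])
            (trans (unary-text (⟦ I ⟧ᶠ 1F)) pred-text)
            (section bottomBlocks [] (trans (unary-text (⟦ I ⟧ᶠ 2F)) bottom-text) refl))
        predicates-text : _ ≡ text x m predicateBlocks
        predicates-text = section ApredBlocks (relationBlocks H ++ verticalBlocks) Apred-text
          (section (relationBlocks H) verticalBlocks (binary-text H (⟦ I ⟧ᵖ 1F) (λ _ _ → refl))
          (section (relationBlocks V₁) (relationBlocks V₀ ++ []) (binary-text V₁ (⟦ I ⟧ᵖ 2F) (λ _ _ → refl))
          (section (relationBlocks V₀) [] (binary-text V₀ (⟦ I ⟧ᵖ 3F) (λ _ _ → refl)) refl)))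

-- The reduction

witness : ∀ {P : Set} (d : Dec P) → does d ≡ true → P
witness (yes p) _ = p

polyTime-cong : ∀ {f g} → (∀ x → f x ≡ g x) → PolyTime f → PolyTime g
polyTime-cong f≡g (M , p , det , time , computes) = M , p , det , time ,
  λ x → let n , c , r , h , out = computes x in n , c , r , h , trans out (f≡g x)

¬-cong : ∀ {P Q : Set} → P ⇔ Q → (¬ P) ⇔ (¬ Q)
¬-cong e = mk⇔ (_∘ Equivalence.from e) (_∘ Equivalence.to e)

module Reduction (M : TM) (p : Polynomial) (inTime : TM.RunsInTime M (evalPoly p))
  {k : ℕ} (enc : Tiles.Tile M → Fin (2 + k)) (dec : Fin (2 + k) → Tiles.Tile M)
  (dec-enc : ∀ s → dec (enc s) ≡ s) where
  open TM M
  open Tiles M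
  open Soundness M
  open Completeness M
  open Encoding dec final (λ b → enc (init b))
    (λ s t → does (horizontal? s t)) (λ s t → does (vertical? true s t)) (λ s t → does (vertical? false s t))

  -- Twice the distance `h` of the completeness proof, with the time bound for the length of the
  -- run, so that both sides of the cut fit.
  width : Polynomial
  width = map (2 *_) ((2 ∷ 1 ∷ []) ⊞ p)

  width-eval : ∀ n → evalPoly width n ≡ (2 + (n + evalPoly p n)) + (2 + (n + evalPoly p n))
  width-eval n = trans (eval-scale 2 ((2 ∷ 1 ∷ []) ⊞ p) n)
    (trans (cong (2 *_) (eval-⊞ (2 ∷ 1 ∷ []) p n)) (rearrange n (evalPoly p n)))
    where
    rearrange : ∀ n T → 2 * ((2 + n * (1 + n * 0)) + T) ≡ (2 + (n + T)) + (2 + (n + T))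
    rearrange = solve-∀

  n≤width : ∀ n → n ≤ evalPoly width n
  n≤width n = subst (n ≤_) (sym (width-eval n))
    (ℕ.≤-trans (ℕ.≤-trans (ℕ.m≤m+n n _) (ℕ.m≤n+m _ 2)) (ℕ.m≤m+n _ _))

  reduction : Word → FiniteStructure objective
  reduction x = instanceOf x (evalPoly width (length x))

  reduction-polyTime : PolyTime (encodeStructure finite-objective ∘ reduction)
  reduction-polyTime = polyTime-cong
    (λ x → sym (encode-text x (evalPoly width (length x)) (n≤width (length x))))
    (text-polyTime width n≤width blocks)

  module _ (x : Word) where

    private
      T m n : ℕ
      T = evalPoly p (length x)
      m = evalPoly width (length x)
      n = suc (k + m)

    decode′ : Fin (suc n) → Tile
    decode′ = decode x m

    code : Tile → Fin (suc n)
    code s = enc s ↑ˡ m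

    decode-code : ∀ s → decode′ (code s) ≡ s
    decode-code s = trans (cong [ dec , (λ _ → final) ]′ (Fin.splitAt-↑ˡ (2 + k) (enc s) m)) (dec-enc s)

    large : (2 + (length x + T)) + (2 + (length x + T)) < n
    large = s≤s (ℕ.≤-trans (ℕ.≤-reflexive (sym (width-eval (length x)))) (ℕ.m≤n+m m (k)))

    large′ : length x + (2 + T) ≤ n
    large′ = ℕ.≤-trans (ℕ.≤-reflexive (rearrange (length x) T)) (ℕ.≤-trans (ℕ.m≤m+n _ _) (ℕ.<⇒≤ large))
      where
      rearrange : ∀ n T → n + (2 + T) ≡ 2 + (n + T)
      rearrange = solve-∀

    satisfiable-accepts : Satisfiable (reduction x) → Accepts x
    satisfiable-accepts sat with Equivalence.to (satisfiable-solves x m) sat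
    ... | τ , holds = sound (λ t p → decode′ (τ t p)) tiling (inTime x) large′
      where
      tiling : Tiling x (λ t p → decode′ (τ t p))
      tiling = record
        { bottom     = λ p → trans (cong decode′ (proj₁ (holds zero p))) (decode-code (init (letter x (toℕ p))))
        ; horizontal = λ t p → witness (horizontal? (decode′ (τ t (cyclicPred p))) (decode′ (τ t p))) (proj₁ (proj₂ (holds t p)))
        ; vertical   = vertical
        }
        where
        vertical : ∀ t p → Vertical (isZero p) (decode′ (τ (cyclicPred t) p)) (decode′ (τ t p))
        vertical t zero with proj₁ (proj₂ (proj₂ (holds t zero)))
        ... | inj₁ z≢z = ⊥-elim (z≢z refl)
        ... | inj₂ v   = witness (vertical? true (decode′ (τ (cyclicPred t) zero)) (decode′ (τ t zero))) v
        vertical t (suc p) with proj₂ (proj₂ (proj₂ (holds t (suc p))))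
        ... | inj₂ v = witness (vertical? false (decode′ (τ (cyclicPred t) (suc p))) (decode′ (τ t (suc p)))) v

    accepts-satisfiable : Accepts x → Satisfiable (reduction x)
    accepts-satisfiable (j , c , r , halted , acc) = Equivalence.from (satisfiable-solves x m)
      ((λ t p → code (τ t p)) , λ t p →
        cong code (bottom p) ,
        holds horizontal? {τ t (cyclicPred p)} {τ t p} (horizontal t p) ,
        atHeads t p , elsewhere t p)
      where
      L≤ : 2 + (length x + j) ≤ 2 + (length x + T)
      L≤ = s≤s (s≤s (ℕ.+-monoʳ-≤ (length x) (inTime x j c r)))
      enough : (2 + (length x + j)) + (2 + (length x + j)) < n
      enough = ℕ.≤-trans (s≤s (ℕ.+-mono-≤ L≤ L≤)) large
      τ : (t p : Fin (suc n)) → Tile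
      τ = computation halted acc r n enough
      tiling : Tiling x τ
      tiling = complete halted acc r n enough
      open Tiling tiling
      holds : {R : Tile → Tile → Set} (R? : ∀ s t → Dec (R s t)) → ∀ {s t} → R s t →
              does (R? (decode′ (code s)) (decode′ (code t))) ≡ true
      holds {R} R? {s} {t} h = dec-true (R? (decode′ (code s)) (decode′ (code t)))
        (subst₂ R (sym (decode-code s)) (sym (decode-code t)) h)
      atHeads : ∀ t p → p ≢ zero
        ⊎ does (vertical? true (decode′ (code (τ (cyclicPred t) p))) (decode′ (code (τ t p)))) ≡ true
      atHeads t zero    = inj₂ (holds (vertical? true) {τ (cyclicPred t) zero} {τ t zero} (vertical t zero))
      atHeads t (suc p) = inj₁ λ ()
      elsewhere : ∀ t p → p ≡ zero
        ⊎ does (vertical? false (decode′ (code (τ (cyclicPred t) p))) (decode′ (code (τ t p)))) ≡ true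
      elsewhere t zero    = inj₁ refl
      elsewhere t (suc p) = inj₂ (holds (vertical? false) {τ (cyclicPred t) (suc p)} {τ t (suc p)} (vertical t (suc p)))

    accepts⇔satisfiable : Accepts x ⇔ Satisfiable (reduction x)
    accepts⇔satisfiable = mk⇔ accepts-satisfiable satisfiable-accepts

  module _ {L : Language} (L⇔ : ∀ x → L x ⇔ Accepts x) where

    ≤ₚ-satisfiable : L ≤ₚ Task1 objective finite-objective subjective emptyTheory agentTerm satisfiable
    ≤ₚ-satisfiable = reduction , reduction-polyTime , λ x →
      ⇔-sym (yes-satisfiable (reduction x)) ⇔-∘ (accepts⇔satisfiable x ⇔-∘ L⇔ x)

    ≤ₚ-unsatisfiable : ∀ {L′ : Language} → (∀ x → L′ x ⇔ (¬ L x)) →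
      L′ ≤ₚ Task1 objective finite-objective subjective emptyTheory agentTerm unsatisfiable
    ≤ₚ-unsatisfiable L′⇔ = reduction , reduction-polyTime , λ x →
      ⇔-sym (yes-unsatisfiable (reduction x)) ⇔-∘ (¬-cong (accepts⇔satisfiable x ⇔-∘ L⇔ x) ⇔-∘ L′⇔ x)

satisfiable-NPHard : NPHard (Task1 objective finite-objective subjective emptyTheory agentTerm satisfiable)
satisfiable-NPHard L (M , p , inTime , L⇔) = ≤ₚ-satisfiable L⇔
  where
  open Tiles M
  -- The number of codes computes to a successor of a successor, since `final` and the `init` tiles
  -- are counted first; this is the form `2 + k` on which the predecessor table relies.
  open Reduction M p inTime (Coded.enc coded-Tile) (Coded.dec coded-Tile) (Coded.dec-enc coded-Tile)

unsatisfiable-CoNPHard : CoNPHard (Task1 objective finite-objective subjective emptyTheory agentTerm unsatisfiable)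
unsatisfiable-CoNPHard L (L′ , (M , p , inTime , L′⇔) , L⇔) = ≤ₚ-unsatisfiable L′⇔ L⇔
  where
  open Tiles M
  open Reduction M p inTime (Coded.enc coded-Tile) (Coded.dec coded-Tile) (Coded.dec-enc coded-Tile)

mainTheorem5 : Σ[ m ∈ ℕ ]
    Σ[ Σₒ ∈ ObjectiveVocabulary m ] Σ[ finₒ ∈ FiniteVocabulary (voc Σₒ) ]
    Σ[ Σₛ ∈ Vocabulary ] Σ[ finₛ ∈ FiniteVocabulary Σₛ ]
    Σ[ T ∈ FiniteTheory m (voc Σₒ ⊎ᵛ Σₛ) ]
    Σ[ t₁ ∈ Term (voc Σₒ) 0 ] Σ[ ψ₁ ∈ Sentence (voc Σₒ ⊎ᵛ Σₛ) ]
    Σ[ t₂ ∈ Term (voc Σₒ) 0 ] Σ[ ψ₂ ∈ Sentence (voc Σₒ ⊎ᵛ Σₛ) ]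
    (NPHard (Task1 Σₒ finₒ Σₛ T t₁ ψ₁) × CoNPHard (Task1 Σₒ finₒ Σₛ T t₂ ψ₂))
mainTheorem5 = 1 , objective , finite-objective , subjective , finite-subjective , emptyTheory ,
  agentTerm , satisfiable , agentTerm , unsatisfiable , satisfiable-NPHard , unsatisfiable-CoNPHard
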